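{- For all integers $n\geq 1$ and $0\leq m\leq n$, \[ K_q(n,m)=\sum_{w\in\mathcal{K}(m,n-m+1)} q^{\mathrm{inv}(w)}=\sum_{w\in\overline{\mathcal{K}}(m,n-m+1)} q^{\mathrm{maj}(w)}. \]
   Context: For integers $n\ge m\ge 0$ the Gaussian polynomial is ${n\brack m}=\prod_{i=0}^{m-1}\frac{1-q^{n-i}}{1-q^{m-i}}$. For $n\geq 1$ and $0\le m\le n$, the $q$-Kaplansky number is $K_q(n,m)=\frac{1-q^{n+m}}{1-q^{n}}{n\brack m}$ (a polynomial in $q$). For a $(0,1)$-sequence $w=w_1w_2\cdots w_N$, $\mathrm{inv}(w)$ is the number of pairs $i<j$ with $w_i>w_j$, and $\mathrm{maj}(w)$ is the sum of all indices $i<N$ with $w_i>w_{i+1}$. $\mathcal{K}(m,n-m+1)$ is the set of $(0,1)$-sequences $w=w_1\cdots w_{n+1}$ of length $n+1$ with exactly $m$ ones and $n-m+1$ zeros such that if $w_{n+1}=1$ then $w_1=0$. $\overline{\mathcal{K}}(m,n-m+1)$ is the set of $(0,1)$-sequences $w=w_1\cdots w_{n+1}$ with exactly $m$ ones and $n-m+1$ zeros such that if $w_{n+1}=1$, then, letting $t=\max\{i: w_i=0\}$, either $t=1$ or ($t\ge 2$ and $w_{t-1}=0$). -}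

module Defs where

open import Data.Empty using (⊥-elim)
open import Data.Fin as Fin using (Fin; zero; suc; toℕ; fromℕ; inject₁)
open import Data.Fin.Patterns using (0F; 1F)
import Data.Fin.Properties as Fin
open import Data.Integer as ℤ using (ℤ; 0ℤ; 1ℤ)
import Data.Integer.Properties as ℤ
open import Data.List as List
  using (List; []; _∷_; _++_; replicate; allFin; cartesianProduct;
         cartesianProductWith; filter; length)
open import Data.List.Membership.Propositional using (_∈_)
open import Data.List.Membership.Propositional.Properties
  using (∈-allFin; ∈-cartesianProductWith⁺)
open import Data.List.Relation.Unary.All using ([])
open import Data.List.Relation.Unary.AllPairs using ([]; _∷_)
open import Data.List.Relation.Unary.Any using (here)
open import Data.List.Relation.Unary.Unique.Propositional using (Unique)
open import Data.List.Relation.Unary.Unique.Propositional.Properties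
  using (allFin⁺; cartesianProductWith⁺)
open import Data.Nat as ℕ using (ℕ; zero; suc; _∸_; NonZero)
open import Data.Nat.ListAction using (sum)
import Data.Nat.Properties as ℕ
open import Data.Product using (_×_; _,_; ∃-syntax)
open import Data.Sum using (_⊎_; inj₁; inj₂; [_,_]′)
open import Data.Vec as Vec using (Vec; []; _∷_; lookup; count)
open import Data.Vec.Properties using (∷-injective)
import Data.Vec.Functional as Vector
open import Function using (_∘_)
open import Relation.Binary.PropositionalEquality
  using (_≡_; _≢_; refl; sym; trans; cong; module ≡-Reasoning)
open import Relation.Nullary using (¬_; yes; no; _×-dec_; _⊎-dec_; _→-dec_)
open import Relation.Unary using (Pred; Decidable)
open import Level using (0ℓ)

------------------------------------------------------------------------
-- The polynomial ring ℤ[q]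

-- Coefficient lists, constant term first.  Trailing zeros are allowed, so
-- equality of polynomials is _≈_ and not _≡_.
Poly : Set
Poly = List ℤ

coeff : Poly → ℕ → ℤ
coeff []      _       = 0ℤ
coeff (a ∷ p) zero    = a
coeff (a ∷ p) (suc k) = coeff p k

infix  4 _≈_ _≉_
infixl 6 _+_ _-_
infixl 7 _*_

_≈_ _≉_ : Poly → Poly → Set
p ≈ r = ∀ k → coeff p k ≡ coeff r k
p ≉ r = ¬ (p ≈ r)

0# 1# : Poly
0# = []
1# = 1ℤ ∷ []

q^_ : ℕ → Poly
q^ k = replicate k 0ℤ ++ 1#

_+_ : Poly → Poly → Poly
[]      + r       = r
(a ∷ p) + []      = a ∷ p
(a ∷ p) + (b ∷ r) = (a ℤ.+ b) ∷ (p + r)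

_-_ : Poly → Poly → Poly
p - r = p + List.map ℤ.-_ r

_*_ : Poly → Poly → Poly
[]      * r = []
(a ∷ p) * r = List.map (a ℤ.*_) r + (0ℤ ∷ p * r)

------------------------------------------------------------------------
-- ℤ[q] is an integral domain

coeff-+ : ∀ p r k → coeff (p + r) k ≡ coeff p k ℤ.+ coeff r k
coeff-+ []      r       k       = sym (ℤ.+-identityˡ (coeff r k))
coeff-+ (a ∷ p) []      k       = sym (ℤ.+-identityʳ (coeff (a ∷ p) k))
coeff-+ (a ∷ p) (b ∷ r) zero    = refl
coeff-+ (a ∷ p) (b ∷ r) (suc k) = coeff-+ p r k

coeff-map-* : ∀ a p k → coeff (List.map (a ℤ.*_) p) k ≡ a ℤ.* coeff p k
coeff-map-* a []      k       = sym (ℤ.*-zeroʳ a)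
coeff-map-* a (b ∷ p) zero    = refl
coeff-map-* a (b ∷ p) (suc k) = coeff-map-* a p k

coeff-∷* : ∀ a p r k →
  coeff ((a ∷ p) * r) k ≡ a ℤ.* coeff r k ℤ.+ coeff (0ℤ ∷ p * r) k
coeff-∷* a p r k =
  trans (coeff-+ (List.map (a ℤ.*_) r) _ k)
        (cong (ℤ._+ coeff (0ℤ ∷ p * r) k) (coeff-map-* a r k))

*-shiftʳ : ∀ p {b} r → b ≡ 0ℤ → p * (b ∷ r) ≈ 0ℤ ∷ p * r
*-shiftʳ []      r refl zero    = refl
*-shiftʳ []      r refl (suc k) = refl
*-shiftʳ (a ∷ p) r refl zero    =
  trans (ℤ.+-identityʳ (a ℤ.* 0ℤ)) (ℤ.*-zeroʳ a)
*-shiftʳ (a ∷ p) r refl (suc k) = begin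
  coeff ((a ∷ p) * (0ℤ ∷ r)) (suc k)           ≡⟨ coeff-∷* a p (0ℤ ∷ r) (suc k) ⟩
  a ℤ.* coeff r k ℤ.+ coeff (p * (0ℤ ∷ r)) k   ≡⟨ cong (λ x → a ℤ.* coeff r k ℤ.+ x) (*-shiftʳ p r refl k) ⟩
  a ℤ.* coeff r k ℤ.+ coeff (0ℤ ∷ p * r) k     ≡⟨ coeff-∷* a p r k ⟨
  coeff ((a ∷ p) * r) k                        ∎
  where open ≡-Reasoning

∷-≈0 : ∀ {a p} → a ≡ 0ℤ → p ≈ 0# → a ∷ p ≈ 0#
∷-≈0 a≡0 p≈0 zero    = a≡0
∷-≈0 a≡0 p≈0 (suc k) = p≈0 k

*-cancel-const≢0 : ∀ {a} p r → a ≢ 0ℤ → (a ∷ p) * r ≈ 0# → r ≈ 0#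
*-cancel-const≢0     p []      a≢0 _  = λ _ → refl
*-cancel-const≢0 {a} p (b ∷ r) a≢0 eq = ∷-≈0 b≡0 (*-cancel-const≢0 p r a≢0 λ k →
    trans (sym (*-shiftʳ (a ∷ p) r b≡0 (suc k))) (eq (suc k)))
  where
  b≡0 : b ≡ 0ℤ
  b≡0 = [ ⊥-elim ∘ a≢0 , (λ e → e) ]′
    (ℤ.i*j≡0⇒i≡0∨j≡0 a (trans (sym (ℤ.+-identityʳ (a ℤ.* b))) (eq 0)))

p*r≈0⇒p≈0∨r≈0 : ∀ p r → p * r ≈ 0# → p ≈ 0# ⊎ r ≈ 0#
p*r≈0⇒p≈0∨r≈0 []      r _  = inj₁ λ _ → refl
p*r≈0⇒p≈0∨r≈0 (a ∷ p) r eq with a ℤ.≟ 0ℤ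
... | no  a≢0  = inj₂ (*-cancel-const≢0 p r a≢0 eq)
... | yes refl = [ inj₁ ∘ ∷-≈0 refl , inj₂ ]′ (p*r≈0⇒p≈0∨r≈0 p r λ k → begin
    coeff (p * r) k                                ≡⟨ ℤ.+-identityˡ _ ⟨
    0ℤ ℤ.* coeff r (suc k) ℤ.+ coeff (p * r) k     ≡⟨ coeff-∷* 0ℤ p r (suc k) ⟨
    coeff ((0ℤ ∷ p) * r) (suc k)                   ≡⟨ eq (suc k) ⟩
    0ℤ                                             ∎)
  where open ≡-Reasoning

*-≉0 : ∀ p r → p ≉ 0# → r ≉ 0# → p * r ≉ 0#
*-≉0 p r p≉0 r≉0 = [ p≉0 , r≉0 ]′ ∘ p*r≈0⇒p≈0∨r≈0 p r

1≉0 : 1# ≉ 0#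
1≉0 eq with () ← eq 0

1-q^≉0 : ∀ k .{{_ : NonZero k}} → 1# - q^ k ≉ 0#
1-q^≉0 (suc k) eq with () ← eq 0

------------------------------------------------------------------------
-- The field of fractions of ℤ[q]

record RatFun : Set where
  constructor _/_⟨_⟩
  field
    num   : Poly
    den   : Poly
    den≉0 : den ≉ 0#

open RatFun public

infix  4 _≃_
infixl 7 _·_

_≃_ : RatFun → RatFun → Set
f ≃ g = num f * den g ≈ num g * den f

fromPoly : Poly → RatFun
fromPoly p = p / 1# ⟨ 1≉0 ⟩

_·_ : RatFun → RatFun → RatFun
f · g = (num f * num g) / (den f * den g) ⟨ *-≉0 (den f) (den g) (den≉0 f) (den≉0 g) ⟩

∏ : ∀ {k} → (Fin k → RatFun) → RatFun
∏ = Vector.foldr _·_ (fromPoly 1#)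

[1-q^_]/[1-q^_] : (a b : ℕ) .{{_ : NonZero b}} → RatFun
[1-q^ a ]/[1-q^ b ] = (1# - q^ a) / (1# - q^ b) ⟨ 1-q^≉0 b ⟩

gaussianFactor : (n m : ℕ) → Fin m → RatFun
gaussianFactor n m i = [1-q^ n ∸ toℕ i ]/[1-q^ m ∸ toℕ i ]
  {{ℕ.>-nonZero (ℕ.m<n⇒0<n∸m (Fin.toℕ<n i))}}

-- Only meaningful for m ≤ n, where no subtraction in a factor is truncated.
gaussian : (n m : ℕ) → RatFun
gaussian n m = ∏ (gaussianFactor n m)

qKaplansky : (n m : ℕ) .{{_ : NonZero n}} → RatFun
qKaplansky n m = [1-q^ n ℕ.+ m ]/[1-q^ n ] · gaussian n m

------------------------------------------------------------------------
-- (0,1)-sequences and their statistics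

-- The letter written w_i (1 ≤ i ≤ N) on paper is the entry of w at the
-- element of Fin N whose value is i - 1.
Word : ℕ → Set
Word N = Vec (Fin 2) N

Inversion : ∀ {N} → Word N → Pred (Fin N × Fin N) 0ℓ
Inversion w (i , j) = i Fin.< j × lookup w i Fin.> lookup w j

inversion? : ∀ {N} (w : Word N) → Decidable (Inversion w)
inversion? w (i , j) = (i Fin.<? j) ×-dec (lookup w j Fin.<? lookup w i)

inv : ∀ {N} → Word N → ℕ
inv {N} w = length (filter (inversion? w) (cartesianProduct (allFin N) (allFin N)))

Descent : ∀ {N} → Word (suc N) → Pred (Fin N) 0ℓ
Descent w i = lookup w (inject₁ i) Fin.> lookup w (suc i)

descent? : ∀ {N} (w : Word (suc N)) → Decidable (Descent w)
descent? w i = lookup w (suc i) Fin.<? lookup w (inject₁ i)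

-- The 1-based index of the descent i is toℕ i + 1.
maj : ∀ {N} → Word (suc N) → ℕ
maj {N} w = sum (List.map (suc ∘ toℕ) (filter (descent? w) (allFin N)))

#ones #zeros : ∀ {N} → Word N → ℕ
#ones  = count (Fin._≟ 1F)
#zeros = count (Fin._≟ 0F)

HasContent : ∀ {N} → (ones zeros : ℕ) → Pred (Word N) 0ℓ
HasContent a b w = #ones w ≡ a × #zeros w ≡ b

hasContent? : ∀ {N} a b → Decidable (HasContent {N} a b)
hasContent? a b w = (#ones w ℕ.≟ a) ×-dec (#zeros w ℕ.≟ b)

-- 𝒦 n m and 𝒦̄ n m are the sets of the words of length n + 1 written
-- 𝒦(m, n-m+1) and 𝒦̄(m, n-m+1) on paper.
𝒦 : (n m : ℕ) → Pred (Word (suc n)) 0ℓ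
𝒦 n m w = HasContent m (n ∸ m ℕ.+ 1) w
        × (lookup w (fromℕ n) ≡ 1F → lookup w zero ≡ 0F)

IsLastZero : ∀ {N} → Word N → Pred (Fin N) 0ℓ
IsLastZero w t = lookup w t ≡ 0F × (∀ i → lookup w i ≡ 0F → i Fin.≤ t)

-- The two disjuncts are "t = 1" and "t ≥ 2 and w_{t-1} = 0" in 1-based indices.
𝒦̄ : (n m : ℕ) → Pred (Word (suc n)) 0ℓ
𝒦̄ n m w = HasContent m (n ∸ m ℕ.+ 1) w
        × (lookup w (fromℕ n) ≡ 1F → ∀ t → IsLastZero w t →
             toℕ t ≡ 0 ⊎ ∃[ s ] (suc (toℕ s) ≡ toℕ t × lookup w s ≡ 0F))

𝒦? : ∀ n m → Decidable (𝒦 n m)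
𝒦? n m w = hasContent? m _ w
  ×-dec ((lookup w (fromℕ n) Fin.≟ 1F) →-dec (lookup w zero Fin.≟ 0F))

isLastZero? : ∀ {N} (w : Word N) → Decidable (IsLastZero w)
isLastZero? w t = (lookup w t Fin.≟ 0F)
  ×-dec Fin.all? λ i → (lookup w i Fin.≟ 0F) →-dec (i Fin.≤? t)

𝒦̄? : ∀ n m → Decidable (𝒦̄ n m)
𝒦̄? n m w = hasContent? m _ w
  ×-dec ((lookup w (fromℕ n) Fin.≟ 1F) →-dec Fin.all? λ t →
    isLastZero? w t →-dec
      ((toℕ t ℕ.≟ 0) ⊎-dec
       Fin.any? λ s → (suc (toℕ s) ℕ.≟ toℕ t) ×-dec (lookup w s Fin.≟ 0F)))

------------------------------------------------------------------------
-- Sums over sets of words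

words : ∀ N → List (Word N)
words zero    = [] ∷ []
words (suc N) = cartesianProductWith _∷_ (allFin 2) (words N)

∈-words : ∀ {N} (w : Word N) → w ∈ words N
∈-words []      = here refl
∈-words (x ∷ w) = ∈-cartesianProductWith⁺ _∷_ (∈-allFin x) (∈-words w)

words-unique : ∀ N → Unique (words N)
words-unique zero    = [] ∷ []
words-unique (suc N) =
  cartesianProductWith⁺ _∷_ ∷-injective (allFin⁺ 2) (words-unique N)

∑-over : ∀ {N} {P : Pred (Word N) 0ℓ} → Decidable P → (Word N → Poly) → Poly
∑-over P? f = List.foldr _+_ 0# (List.map f (filter P? (words _)))

syntax ∑-over P? (λ w → f) = ∑[ w ∈ P? ] f

{-# OPTIONS --safe #-}

-- Split the words by their last letter.  In both families the words w0 have
-- generating function q^m [n, m], and the words w1 have [n-1, m-1]: for inv they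
-- are 0u1 with u arbitrary, and for maj they arise from an arbitrary u by
-- inserting 01 after its last zero (or in front), which keeps maj unchanged.
-- The absorption identity (1 - q^m) [n, m] = (1 - q^n) [n-1, m-1] then turns
-- q^m [n, m] + [n-1, m-1] into K_q(n, m).  Splitting by the last letter also gives
-- the equidistribution of inv and maj, carried through an induction together
-- with the statement that the words w0 with a ones and b + 1 zeros have
-- maj-generating function q^a [a+b, a].

module Submission where

open import Algebra.Bundles using (CommutativeRing)
open import Data.Bool using (true; false; if_then_else_)
open import Data.Fin as Fin using (Fin; zero; suc; toℕ; fromℕ; inject₁)
open import Data.Fin.Patterns using (0F; 1F)
import Data.Fin.Properties as Fin
open import Data.Fin.Relation.Unary.Top using (view; ‵fromℕ; ‵inject₁)
open import Data.Integer as ℤ using (ℤ; 0ℤ; 1ℤ)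
import Data.Integer.Properties as ℤ
open import Data.Integer.Solver using (module +-*-Solver)
open import Data.List as List
  using (List; []; _∷_; _++_; filter; length; allFin; cartesianProduct)
import Data.List.Properties as List
open import Data.Maybe using (Maybe; just; nothing)
open import Data.Nat as ℕ using (ℕ; zero; suc; _≤_; z≤n; s≤s; _∸_; NonZero)
open import Data.Nat.ListAction using (sum)
import Data.Nat.Properties as ℕ
open import Algebra.Properties.CommutativeSemigroup ℕ.+-commutativeSemigroup using (x∙yz≈y∙xz)
open import Data.Product using (_×_; _,_; proj₁; proj₂; ∃-syntax)
open import Data.Sum using (_⊎_; inj₁; inj₂)
open import Data.Vec using (Vec; []; _∷_; _∷ʳ_; lookup; count)
open import Function using (_∘_; _⇔_; mk⇔; Equivalence)
open import Level using (0ℓ)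
import Relation.Binary.Reasoning.Setoid
open import Relation.Binary.PropositionalEquality
  using (_≡_; refl; sym; trans; cong; cong₂; subst; subst₂; module ≡-Reasoning)
open import Relation.Binary.Structures using (IsEquivalence)
open import Relation.Nullary
  using (¬_; Dec; yes; no; does; contradiction; _×-dec_; _⊎-dec_; _→-dec_)
open import Relation.Nullary.Decidable using (dec-true; dec-false; does-⇔)
open import Relation.Unary using (Pred; Decidable)
open import Tactic.RingSolver using (solve-∀)
open import Tactic.RingSolver.Core.AlmostCommutativeRing
  using (AlmostCommutativeRing; fromCommutativeRing)
open import Defs

-- The ring ℤ[q]

-- A record because p and r cannot be inferred from the type p ≈ r, which unfolds.
infix 4 _≋_
record _≋_ (p r : Poly) : Set where
  constructor mk≋
  field coeffs : p ≈ r
open _≋_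

≋-isEquivalence : IsEquivalence _≋_
≋-isEquivalence = record
  { refl  = mk≋ λ _ → refl
  ; sym   = λ e → mk≋ λ k → sym (coeffs e k)
  ; trans = λ e f → mk≋ λ k → trans (coeffs e k) (coeffs f k)
  }

open IsEquivalence ≋-isEquivalence using ()
  renaming (refl to ≋-refl; sym to ≋-sym; trans to ≋-trans)

neg : Poly → Poly
neg p = List.map ℤ.-_ p

coeff-neg : ∀ p k → coeff (neg p) k ≡ ℤ.- coeff p k
coeff-neg []      k       = refl
coeff-neg (a ∷ p) zero    = refl
coeff-neg (a ∷ p) (suc k) = coeff-neg p k

+-cong : ∀ {p p′ r r′} → p ≋ p′ → r ≋ r′ → p + r ≋ p′ + r′
+-cong {p} {p′} {r} {r′} e f = mk≋ λ k → begin
  coeff (p + r) k              ≡⟨ coeff-+ p r k ⟩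
  coeff p k ℤ.+ coeff r k      ≡⟨ cong₂ ℤ._+_ (coeffs e k) (coeffs f k) ⟩
  coeff p′ k ℤ.+ coeff r′ k    ≡⟨ coeff-+ p′ r′ k ⟨
  coeff (p′ + r′) k            ∎
  where open ≡-Reasoning

+-congˡ : ∀ p {r r′} → r ≋ r′ → p + r ≋ p + r′
+-congˡ p e = +-cong (≋-refl {p}) e

+-congʳ : ∀ r {p p′} → p ≋ p′ → p + r ≋ p′ + r
+-congʳ r e = +-cong e (≋-refl {r})

+-comm : ∀ p r → p + r ≋ r + p
+-comm p r = mk≋ λ k → begin
  coeff (p + r) k              ≡⟨ coeff-+ p r k ⟩
  coeff p k ℤ.+ coeff r k      ≡⟨ ℤ.+-comm (coeff p k) (coeff r k) ⟩
  coeff r k ℤ.+ coeff p k      ≡⟨ coeff-+ r p k ⟨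
  coeff (r + p) k              ∎
  where open ≡-Reasoning

+-assoc : ∀ p r s → (p + r) + s ≋ p + (r + s)
+-assoc p r s = mk≋ λ k → begin
  coeff ((p + r) + s) k                      ≡⟨ coeff-+ (p + r) s k ⟩
  coeff (p + r) k ℤ.+ coeff s k              ≡⟨ cong (ℤ._+ coeff s k) (coeff-+ p r k) ⟩
  coeff p k ℤ.+ coeff r k ℤ.+ coeff s k      ≡⟨ ℤ.+-assoc (coeff p k) (coeff r k) (coeff s k) ⟩
  coeff p k ℤ.+ (coeff r k ℤ.+ coeff s k)    ≡⟨ cong (ℤ._+_ (coeff p k)) (coeff-+ r s k) ⟨
  coeff p k ℤ.+ coeff (r + s) k              ≡⟨ coeff-+ p (r + s) k ⟨
  coeff (p + (r + s)) k                      ∎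
  where open ≡-Reasoning

+-identityʳ : ∀ p → p + 0# ≋ p
+-identityʳ p = +-comm p 0#

neg-cong : ∀ {p r} → p ≋ r → neg p ≋ neg r
neg-cong {p} {r} e = mk≋ λ k →
  trans (coeff-neg p k) (trans (cong ℤ.-_ (coeffs e k)) (sym (coeff-neg r k)))

+-inverseˡ : ∀ p → neg p + p ≋ 0#
+-inverseˡ p = mk≋ λ k → begin
  coeff (neg p + p) k              ≡⟨ coeff-+ (neg p) p k ⟩
  coeff (neg p) k ℤ.+ coeff p k    ≡⟨ cong (ℤ._+ coeff p k) (coeff-neg p k) ⟩
  ℤ.- coeff p k ℤ.+ coeff p k      ≡⟨ ℤ.+-inverseˡ (coeff p k) ⟩
  0ℤ                               ∎
  where open ≡-Reasoning

+-inverseʳ : ∀ p → p + neg p ≋ 0#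
+-inverseʳ p = ≋-trans (+-comm p (neg p)) (+-inverseˡ p)

∷-cong : ∀ {a p r} → p ≋ r → a ∷ p ≋ a ∷ r
∷-cong e = mk≋ λ { zero → refl ; (suc k) → coeffs e k }

infixr 8 _∙_
-- Scalar multiplication, in the form in which it occurs in the defining clause of `_*_`, so that
-- products unfold to it by computation.
_∙_ : ℤ → Poly → Poly
a ∙ p = List.map (a ℤ.*_) p

∙-cong : ∀ a {p r} → p ≋ r → a ∙ p ≋ a ∙ r
∙-cong a {p} {r} e = mk≋ λ k → begin
  coeff (a ∙ p) k    ≡⟨ coeff-map-* a p k ⟩
  a ℤ.* coeff p k    ≡⟨ cong (a ℤ.*_) (coeffs e k) ⟩
  a ℤ.* coeff r k    ≡⟨ coeff-map-* a r k ⟨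
  coeff (a ∙ r) k    ∎
  where open ≡-Reasoning

∙-+ˡ : ∀ a b p → (a ℤ.+ b) ∙ p ≋ a ∙ p + b ∙ p
∙-+ˡ a b p = mk≋ λ k → begin
  coeff ((a ℤ.+ b) ∙ p) k                  ≡⟨ coeff-map-* (a ℤ.+ b) p k ⟩
  (a ℤ.+ b) ℤ.* coeff p k                  ≡⟨ ℤ.*-distribʳ-+ (coeff p k) a b ⟩
  a ℤ.* coeff p k ℤ.+ b ℤ.* coeff p k      ≡⟨ cong₂ ℤ._+_ (coeff-map-* a p k) (coeff-map-* b p k) ⟨
  coeff (a ∙ p) k ℤ.+ coeff (b ∙ p) k      ≡⟨ coeff-+ (a ∙ p) (b ∙ p) k ⟨
  coeff (a ∙ p + b ∙ p) k                  ∎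
  where open ≡-Reasoning

∙-∙ : ∀ a b p → (a ℤ.* b) ∙ p ≋ a ∙ b ∙ p
∙-∙ a b p = mk≋ λ k → begin
  coeff ((a ℤ.* b) ∙ p) k      ≡⟨ coeff-map-* (a ℤ.* b) p k ⟩
  (a ℤ.* b) ℤ.* coeff p k      ≡⟨ ℤ.*-assoc a b (coeff p k) ⟩
  a ℤ.* (b ℤ.* coeff p k)      ≡⟨ cong (a ℤ.*_) (coeff-map-* b p k) ⟨
  a ℤ.* coeff (b ∙ p) k        ≡⟨ coeff-map-* a (b ∙ p) k ⟨
  coeff (a ∙ b ∙ p) k          ∎
  where open ≡-Reasoning

∙-+ʳ : ∀ a p r → a ∙ (p + r) ≋ a ∙ p + a ∙ r
∙-+ʳ a p r = mk≋ λ k → begin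
  coeff (a ∙ (p + r)) k                    ≡⟨ coeff-map-* a (p + r) k ⟩
  a ℤ.* coeff (p + r) k                    ≡⟨ cong (a ℤ.*_) (coeff-+ p r k) ⟩
  a ℤ.* (coeff p k ℤ.+ coeff r k)          ≡⟨ ℤ.*-distribˡ-+ a (coeff p k) (coeff r k) ⟩
  a ℤ.* coeff p k ℤ.+ a ℤ.* coeff r k      ≡⟨ cong₂ ℤ._+_ (coeff-map-* a p k) (coeff-map-* a r k) ⟨
  coeff (a ∙ p) k ℤ.+ coeff (a ∙ r) k      ≡⟨ coeff-+ (a ∙ p) (a ∙ r) k ⟨
  coeff (a ∙ p + a ∙ r) k                  ∎
  where open ≡-Reasoning

∙-identity : ∀ p → 1ℤ ∙ p ≋ p
∙-identity p = mk≋ λ k → trans (coeff-map-* 1ℤ p k) (ℤ.*-identityˡ (coeff p k))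

∙-zero : ∀ p → 0ℤ ∙ p ≋ 0#
∙-zero p = mk≋ λ k → trans (coeff-map-* 0ℤ p k) (ℤ.*-zeroˡ (coeff p k))

0∷[]≋0 : 0ℤ ∷ [] ≋ 0#
0∷[]≋0 = mk≋ λ { zero → refl ; (suc _) → refl }

interchange : ∀ p r s t → (p + r) + (s + t) ≋ (p + s) + (r + t)
interchange p r s t = mk≋ λ k → begin
  coeff ((p + r) + (s + t)) k    ≡⟨ expand p r s t k ⟩
  (coeff p k ℤ.+ coeff r k) ℤ.+ (coeff s k ℤ.+ coeff t k)
    ≡⟨ solve 4 (λ a b c d → (a :+ b) :+ (c :+ d) := (a :+ c) :+ (b :+ d)) refl
         (coeff p k) (coeff r k) (coeff s k) (coeff t k) ⟩
  (coeff p k ℤ.+ coeff s k) ℤ.+ (coeff r k ℤ.+ coeff t k)    ≡⟨ expand p s r t k ⟨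
  coeff ((p + s) + (r + t)) k    ∎
  where
  open ≡-Reasoning
  open +-*-Solver
  expand : ∀ p r s t k → coeff ((p + r) + (s + t)) k
         ≡ (coeff p k ℤ.+ coeff r k) ℤ.+ (coeff s k ℤ.+ coeff t k)
  expand p r s t k =
    trans (coeff-+ (p + r) (s + t) k) (cong₂ ℤ._+_ (coeff-+ p r k) (coeff-+ s t k))

*-congˡ : ∀ p {r r′} → r ≋ r′ → p * r ≋ p * r′
*-congˡ []      e = ≋-refl
*-congˡ (a ∷ p) e = +-cong (∙-cong a e) (∷-cong (*-congˡ p e))

*-zeroʳ : ∀ p → p * 0# ≋ 0#
*-zeroʳ []      = ≋-refl
*-zeroʳ (a ∷ p) = ≋-trans (∷-cong (*-zeroʳ p)) 0∷[]≋0

-- The mirror image of the defining clause of `_*_`, which recurses on the left factor. It turns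
-- commutativity into an induction on one factor.
*-∷ʳ : ∀ p b r → p * (b ∷ r) ≋ b ∙ p + (0ℤ ∷ p * r)
*-∷ʳ []      b r = ≋-sym 0∷[]≋0
*-∷ʳ (a ∷ p) b r = mk≋ λ
  { zero    → cong (ℤ._+ 0ℤ) (ℤ.*-comm a b)
  ; (suc k) → coeffs tail k
  }
  where
  tail : a ∙ r + p * (b ∷ r) ≋ b ∙ p + (a ∙ r + (0ℤ ∷ p * r))
  tail = ≋-trans (+-cong (≋-refl {a ∙ r}) (*-∷ʳ p b r))
        (≋-trans (≋-sym (+-assoc (a ∙ r) (b ∙ p) _))
        (≋-trans (+-cong (+-comm (a ∙ r) (b ∙ p)) ≋-refl)
                 (+-assoc (b ∙ p) (a ∙ r) _)))

*-comm : ∀ p r → p * r ≋ r * p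
*-comm []      r = ≋-sym (*-zeroʳ r)
*-comm (a ∷ p) r = ≋-trans (+-cong ≋-refl (∷-cong (*-comm p r))) (≋-sym (*-∷ʳ r a p))

-- Equal polynomials may be lists of different lengths, so a change of the left factor does not
-- follow the recursion of `_*_`. Commutativity moves it to the right.
*-cong : ∀ {p p′ r r′} → p ≋ p′ → r ≋ r′ → p * r ≋ p′ * r′
*-cong {p} {p′} {r} {r′} e f =
  ≋-trans (*-congˡ p f) (≋-trans (*-comm p r′) (≋-trans (*-congˡ r′ e) (*-comm r′ p′)))

*-congʳ : ∀ r {p p′} → p ≋ p′ → p * r ≋ p′ * r
*-congʳ r e = *-cong e (≋-refl {r})

*-distribʳ-+ : ∀ r p s → (p + s) * r ≋ p * r + s * r
*-distribʳ-+ r []      s       = ≋-refl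
*-distribʳ-+ r (a ∷ p) []      = ≋-sym (+-identityʳ ((a ∷ p) * r))
*-distribʳ-+ r (a ∷ p) (b ∷ s) =
  ≋-trans (+-cong (∙-+ˡ a b r) (∷-cong (*-distribʳ-+ r p s)))
          (interchange (a ∙ r) (b ∙ r) (0ℤ ∷ p * r) (0ℤ ∷ s * r))

*-distribˡ-+ : ∀ r p s → r * (p + s) ≋ r * p + r * s
*-distribˡ-+ r p s =
  ≋-trans (*-comm r (p + s))
  (≋-trans (*-distribʳ-+ r p s) (+-cong (*-comm p r) (*-comm s r)))

0∷-* : ∀ p r → (0ℤ ∷ p) * r ≋ 0ℤ ∷ p * r
0∷-* p r = +-cong (∙-zero r) ≋-refl

∙-* : ∀ a p r → (a ∙ p) * r ≋ a ∙ (p * r)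
∙-* a []      r = ≋-refl
∙-* a (b ∷ p) r = ≋-trans (+-cong (∙-∙ a b r) tail) (≋-sym (∙-+ʳ a (b ∙ r) (0ℤ ∷ p * r)))
  where
  tail : 0ℤ ∷ (a ∙ p) * r ≋ a ∙ (0ℤ ∷ p * r)
  tail = mk≋ λ { zero → sym (ℤ.*-zeroʳ a) ; (suc k) → coeffs (∙-* a p r) k }

*-assoc : ∀ p r s → (p * r) * s ≋ p * (r * s)
*-assoc []      r s = ≋-refl
*-assoc (a ∷ p) r s =
  ≋-trans (*-distribʳ-+ s (a ∙ r) (0ℤ ∷ p * r))
    (+-cong (∙-* a r s) (≋-trans (0∷-* (p * r) s) (∷-cong (*-assoc p r s))))

*-identityˡ : ∀ p → 1# * p ≋ p
*-identityˡ p = ≋-trans (+-cong (∙-identity p) 0∷[]≋0) (+-identityʳ p)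

*-identityʳ : ∀ p → p * 1# ≋ p
*-identityʳ p = ≋-trans (*-comm p 1#) (*-identityˡ p)

ℤ[q] : CommutativeRing 0ℓ 0ℓ
ℤ[q] = record
  { Carrier = Poly
  ; _≈_ = _≋_
  ; _+_ = _+_
  ; _*_ = _*_
  ; -_  = neg
  ; 0#  = 0#
  ; 1#  = 1#
  ; isCommutativeRing = record
    { isRing = record
      { +-isAbelianGroup = record
        { isGroup = record
          { isMonoid = record
            { isSemigroup = record
              { isMagma = record { isEquivalence = ≋-isEquivalence ; ∙-cong = +-cong }
              ; assoc = +-assoc
              }
            ; identity = (λ _ → ≋-refl) , +-identityʳ
            }
          ; inverse = +-inverseˡ , +-inverseʳ
          ; ⁻¹-cong = neg-cong
          }
        ; comm = +-comm
        }
      ; *-cong = *-cong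
      ; *-assoc = *-assoc
      ; *-identity = *-identityˡ , *-identityʳ
      ; distrib = *-distribˡ-+ , *-distribʳ-+
      }
    ; *-comm = *-comm
    }
  }

module ≈-Reasoning = Relation.Binary.Reasoning.Setoid (CommutativeRing.setoid ℤ[q])

-- Lets the ring solver recognise vanishing coefficients. The answer `nothing` only makes the solver
-- weaker.
isZero? : ∀ p → Maybe (0# ≋ p)
isZero? []      = just ≋-refl
isZero? (a ∷ p) with a ℤ.≟ 0ℤ | isZero? p
... | yes a≡0 | just 0≋p = just (≋-sym (mk≋ (∷-≈0 a≡0 (coeffs (≋-sym 0≋p)))))
... | _       | _        = nothing

ring : AlmostCommutativeRing 0ℓ 0ℓ
ring = fromCommutativeRing ℤ[q] isZero?

≡⇒≋ : ∀ {p r} → p ≡ r → p ≋ r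
≡⇒≋ refl = ≋-refl

q^-+ : ∀ a b → q^ (a ℕ.+ b) ≋ q^ a * q^ b
q^-+ zero    b = ≋-sym (*-identityˡ (q^ b))
q^-+ (suc a) b = ≋-trans (∷-cong (q^-+ a b)) (≋-sym (0∷-* (q^ a) (q^ b)))

1-cong : ∀ {p r} → p ≋ r → 1# - p ≋ 1# - r
1-cong e = +-congˡ 1# (neg-cong e)

-- The Gaussian polynomials

-- qbinom a b is [a + b, a].
qbinom : ℕ → ℕ → Poly
qbinom zero    b       = 1#
qbinom (suc a) zero    = 1#
qbinom (suc a) (suc b) = qbinom (suc a) b + q^ suc b * qbinom a (suc b)

qbinom-zeroʳ : ∀ a → qbinom a 0 ≡ 1#
qbinom-zeroʳ zero    = refl
qbinom-zeroʳ (suc a) = refl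

mutual
  -- Both absorption identities come from one mutual induction. The recursion of `qbinom` produces
  -- `(1 - x) u` and `(1 - y) v`, which both equal `(1 - z) w` by the two hypotheses at `a`, `b`.
  -- Exchanging one for the other leaves a common factor times `(1 - y) + y (1 - x) = 1 - x y`.
  qbinom-absorbˡ : ∀ a b →
    (1# - q^ suc a) * qbinom (suc a) b ≋ (1# - q^ suc (a ℕ.+ b)) * qbinom a b
  qbinom-absorbˡ a zero    = ≡⇒≋ (cong₂ (λ x y → (1# - q^ suc x) * y)
    (sym (ℕ.+-identityʳ a)) (sym (qbinom-zeroʳ a)))
  qbinom-absorbˡ a (suc b) = begin
    (1# - x) * (u + y * v)               ≈⟨ split x y u v ⟩
    (1# - x) * u + y * ((1# - x) * v)    ≈⟨ +-congʳ (y * ((1# - x) * v)) (qbinom-absorbˡ a b) ⟩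
    (1# - z) * w + y * ((1# - x) * v)    ≈⟨ +-congʳ (y * ((1# - x) * v)) (≋-sym (qbinom-absorbʳ a b)) ⟩
    (1# - y) * v + y * ((1# - x) * v)    ≈⟨ merge x y v ⟩
    (1# - x * y) * v                     ≈⟨ *-congʳ v (1-cong (q^-+ (suc a) (suc b))) ⟨
    (1# - q^ suc (a ℕ.+ suc b)) * v      ∎
    where
    open ≈-Reasoning
    x = q^ suc a
    y = q^ suc b
    z = q^ suc (a ℕ.+ b)
    u = qbinom (suc a) b
    v = qbinom a (suc b)
    w = qbinom a b
    split : ∀ x y u v → (1# - x) * (u + y * v) ≋ (1# - x) * u + y * ((1# - x) * v)
    split = solve-∀ ring
    merge : ∀ x y v → (1# - y) * v + y * ((1# - x) * v) ≋ (1# - x * y) * v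
    merge = solve-∀ ring

  qbinom-absorbʳ : ∀ a b →
    (1# - q^ suc b) * qbinom a (suc b) ≋ (1# - q^ suc (a ℕ.+ b)) * qbinom a b
  qbinom-absorbʳ zero    b = ≋-refl
  qbinom-absorbʳ (suc a) b = begin
    (1# - y) * (u + y * v)                      ≈⟨ split y u v ⟩
    (1# - y) * u + y * ((1# - y) * v)           ≈⟨ +-congˡ ((1# - y) * u) (*-congˡ y (qbinom-absorbʳ a b)) ⟩
    (1# - y) * u + y * ((1# - z) * w)           ≈⟨ +-congˡ ((1# - y) * u) (*-congˡ y (qbinom-absorbˡ a b)) ⟨
    (1# - y) * u + y * ((1# - x) * u)           ≈⟨ merge x y u ⟩
    (1# - x * y) * u                            ≈⟨ *-congʳ u (1-cong (q^-+ (suc a) (suc b))) ⟨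
    (1# - q^ (suc a ℕ.+ suc b)) * u             ≡⟨ cong (λ k → (1# - q^ k) * u) (ℕ.+-suc (suc a) b) ⟩
    (1# - q^ suc (suc a ℕ.+ b)) * u             ∎
    where
    open ≈-Reasoning
    x = q^ suc a
    y = q^ suc b
    z = q^ suc (a ℕ.+ b)
    u = qbinom (suc a) b
    v = qbinom a (suc b)
    w = qbinom a b
    split : ∀ y u v → (1# - y) * (u + y * v) ≋ (1# - y) * u + y * ((1# - y) * v)
    split = solve-∀ ring
    merge : ∀ x y u → (1# - y) * u + y * ((1# - x) * u) ≋ (1# - x * y) * u
    merge = solve-∀ ring

-- Lowering `n` and `m` together strips the factor with index 0 and turns the remaining factors into
-- those of `gaussian n m` by computation, while `n ∸ m` stays fixed. The stripped factor is the
-- ratio in `qbinom-absorbˡ`. The denominator is multiplied out because `gaussian` is a fraction.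
gaussian≋qbinom : ∀ {n m} → m ≤ n →
  num (gaussian n m) ≋ qbinom m (n ∸ m) * den (gaussian n m)
gaussian≋qbinom z≤n = ≋-sym (*-identityˡ 1#)
gaussian≋qbinom {suc n} {suc m} (s≤s m≤n) = begin
  (1# - q^ suc n) * g                                  ≈⟨ *-congˡ (1# - q^ suc n) (gaussian≋qbinom m≤n) ⟩
  (1# - q^ suc n) * (qbinom m (n ∸ m) * d)             ≈⟨ *-assoc (1# - q^ suc n) (qbinom m (n ∸ m)) d ⟨
  (1# - q^ suc n) * qbinom m (n ∸ m) * d               ≡⟨ cong (λ k → (1# - q^ suc k) * qbinom m (n ∸ m) * d) (ℕ.m+[n∸m]≡n m≤n) ⟨
  (1# - q^ suc (m ℕ.+ (n ∸ m))) * qbinom m (n ∸ m) * d ≈⟨ *-congʳ d (qbinom-absorbˡ m (n ∸ m)) ⟨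
  (1# - q^ suc m) * qbinom (suc m) (n ∸ m) * d         ≈⟨ *-congʳ d (*-comm (1# - q^ suc m) (qbinom (suc m) (n ∸ m))) ⟩
  qbinom (suc m) (n ∸ m) * (1# - q^ suc m) * d         ≈⟨ *-assoc (qbinom (suc m) (n ∸ m)) (1# - q^ suc m) d ⟩
  qbinom (suc m) (n ∸ m) * ((1# - q^ suc m) * d)       ∎
  where
  open ≈-Reasoning
  g = num (gaussian n m)
  d = den (gaussian n m)

-- The value of K_q(a + b, a) that results from splitting words by their last letter.
kaplansky : ℕ → ℕ → Poly
kaplansky zero    b = 1#
kaplansky (suc a) b = q^ suc a * qbinom (suc a) b + qbinom a b

-- With x = q^m and y = q^n, write `1 - y x = x (1 - y) + (1 - x)`. Absorption makes `1 - y` a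
-- factor of the second summand as well.
kaplansky-qbinom : ∀ a b →
  (1# - q^ (a ℕ.+ b ℕ.+ a)) * qbinom a b ≋ kaplansky a b * (1# - q^ (a ℕ.+ b))
kaplansky-qbinom zero    b = begin
  (1# - q^ (b ℕ.+ 0)) * 1#    ≡⟨ cong (λ k → (1# - q^ k) * 1#) (ℕ.+-identityʳ b) ⟩
  (1# - q^ b) * 1#            ≈⟨ *-comm (1# - q^ b) 1# ⟩
  1# * (1# - q^ b)            ∎
  where open ≈-Reasoning
kaplansky-qbinom (suc a) b = begin
  (1# - q^ (n ℕ.+ suc a)) * u              ≈⟨ *-congʳ u (1-cong (q^-+ n (suc a))) ⟩
  (1# - y * x) * u                         ≈⟨ split x y u ⟩
  x * u * (1# - y) + (1# - x) * u          ≈⟨ +-congˡ (x * u * (1# - y)) (qbinom-absorbˡ a b) ⟩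
  x * u * (1# - y) + (1# - y) * v          ≈⟨ merge x y u v ⟩
  (x * u + v) * (1# - y)                   ∎
  where
  open ≈-Reasoning
  n = suc a ℕ.+ b
  x = q^ suc a
  y = q^ n
  u = qbinom (suc a) b
  v = qbinom a b
  split : ∀ x y u → (1# - y * x) * u ≋ x * u * (1# - y) + (1# - x) * u
  split = solve-∀ ring
  merge : ∀ x y u v → x * u * (1# - y) + (1# - y) * v ≋ (x * u + v) * (1# - y)
  merge = solve-∀ ring

qKaplansky≃kaplansky : ∀ {n m} .{{_ : NonZero n}} → m ≤ n →
  qKaplansky n m ≃ fromPoly (kaplansky m (n ∸ m))
qKaplansky≃kaplansky {n} {m} m≤n = coeffs (begin
  e * g * 1#                     ≈⟨ *-identityʳ (e * g) ⟩
  e * g                          ≈⟨ *-congˡ e (gaussian≋qbinom m≤n) ⟩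
  e * (qbinom m b * d)           ≈⟨ *-assoc e (qbinom m b) d ⟨
  e * qbinom m b * d             ≈⟨ *-congʳ d identity ⟩
  kaplansky m b * (1# - q^ n) * d    ≈⟨ *-assoc (kaplansky m b) (1# - q^ n) d ⟩
  kaplansky m b * ((1# - q^ n) * d)  ∎)
  where
  open ≈-Reasoning
  b = n ∸ m
  e = 1# - q^ (n ℕ.+ m)
  g = num (gaussian n m)
  d = den (gaussian n m)
  identity : e * qbinom m b ≋ kaplansky m b * (1# - q^ n)
  identity = subst (λ k → (1# - q^ (k ℕ.+ m)) * qbinom m b ≋ kaplansky m b * (1# - q^ k))
    (ℕ.m+[n∸m]≡n m≤n) (kaplansky-qbinom m b)

-- Sums over words

-- The shape to which `∑-over` unfolds: a sum over a decidable set of words is definitionally `∑` of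
-- a filtered list.
∑ : ∀ {A : Set} → List A → (A → Poly) → Poly
∑ xs f = List.foldr _+_ 0# (List.map f xs)

module _ {A : Set} where

  ∑-cong : ∀ (xs : List A) {f g} → (∀ x → f x ≋ g x) → ∑ xs f ≋ ∑ xs g
  ∑-cong []       f≋g = ≋-refl
  ∑-cong (x ∷ xs) f≋g = +-cong (f≋g x) (∑-cong xs f≋g)

  ∑-zero : ∀ (xs : List A) → ∑ xs (λ _ → 0#) ≋ 0#
  ∑-zero []       = ≋-refl
  ∑-zero (x ∷ xs) = ∑-zero xs

  ∑-++ : ∀ (xs ys : List A) f → ∑ (xs ++ ys) f ≋ ∑ xs f + ∑ ys f
  ∑-++ []       ys f = ≋-refl
  ∑-++ (x ∷ xs) ys f = ≋-trans (+-congˡ (f x) (∑-++ xs ys f)) (≋-sym (+-assoc (f x) _ _))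

  ∑-*ˡ : ∀ p (xs : List A) f → ∑ xs (λ x → p * f x) ≋ p * ∑ xs f
  ∑-*ˡ p []       f = ≋-sym (*-zeroʳ p)
  ∑-*ˡ p (x ∷ xs) f =
    ≋-trans (+-congˡ (p * f x) (∑-*ˡ p xs f)) (≋-sym (*-distribˡ-+ p (f x) (∑ xs f)))

∑-map : ∀ {A B : Set} (g : A → B) xs f → ∑ (List.map g xs) f ≡ ∑ xs (f ∘ g)
∑-map g xs f = cong (List.foldr _+_ 0#) (sym (List.map-∘ xs))

-- Replaces filtering by zero summands, so that all sums range over the full list of words and can
-- be split by letters and compared term by term. Using only `does` makes the value independent of
-- the proof inside the decision.
guard : ∀ {P : Set} → Dec P → Poly → Poly
guard P? p = if does P? then p else 0#

module _ {P : Set} where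

  guard-yes : ∀ (P? : Dec P) {p} → P → guard P? p ≡ p
  guard-yes P? {p} h = cong (if_then p else 0#) (dec-true P? h)

  guard-no : ∀ (P? : Dec P) {p} → ¬ P → guard P? p ≡ 0#
  guard-no P? {p} h = cong (if_then p else 0#) (dec-false P? h)

  guard-⇔ : ∀ {Q : Set} (P? : Dec P) (Q? : Dec Q) {p} → P ⇔ Q → guard P? p ≡ guard Q? p
  guard-⇔ P? Q? {p} P⇔Q = cong (if_then p else 0#) (does-⇔ P⇔Q P? Q?)

  guard-cong : ∀ (P? : Dec P) {p r} → (P → p ≋ r) → guard P? p ≋ guard P? r
  guard-cong (yes h) p≋r = p≋r h
  guard-cong (no _)  p≋r = ≋-refl

  guard-*ˡ : ∀ (P? : Dec P) p r → guard P? (p * r) ≋ p * guard P? r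
  guard-*ˡ (yes _) p r = ≋-refl
  guard-*ˡ (no _)  p r = ≋-sym (*-zeroʳ p)

  guard-× : ∀ {Q : Set} (P? : Dec P) (Q? : Dec Q) p →
    guard (P? ×-dec Q?) p ≡ guard P? (guard Q? p)
  guard-× (yes _) Q? p = refl
  guard-× (no _)  Q? p = refl

∑-filter : ∀ {A : Set} {P : Pred A 0ℓ} (P? : Decidable P) xs f →
  ∑ (filter P? xs) f ≋ ∑ xs (λ x → guard (P? x) (f x))
∑-filter P? []       f = ≋-refl
∑-filter P? (x ∷ xs) f with P? x
... | yes _ = +-congˡ (f x) (∑-filter P? xs f)
... | no _  = ∑-filter P? xs f

∑-words-∷ : ∀ N f → ∑ (words (suc N)) f ≋ ∑ (words N) (f ∘ (0F ∷_)) + ∑ (words N) (f ∘ (1F ∷_))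
∑-words-∷ N f = begin
  ∑ (map₀ ++ (map₁ ++ [])) f              ≡⟨ cong (λ l → ∑ (map₀ ++ l) f) (List.++-identityʳ map₁) ⟩
  ∑ (map₀ ++ map₁) f                      ≈⟨ ∑-++ map₀ map₁ f ⟩
  ∑ map₀ f + ∑ map₁ f                     ≡⟨ cong₂ _+_ (∑-map (0F ∷_) (words N) f) (∑-map (1F ∷_) (words N) f) ⟩
  ∑ (words N) (f ∘ (0F ∷_)) + ∑ (words N) (f ∘ (1F ∷_)) ∎
  where
  open ≈-Reasoning
  map₀ map₁ : List (Word (suc N))
  map₀ = List.map (0F ∷_) (words N)
  map₁ = List.map (1F ∷_) (words N)

-- `words` branches on the first letter. Induction below that letter gives four sums, which
-- `interchange` regroups by the last letter.
∑-words-∷ʳ : ∀ N f → ∑ (words (suc N)) f ≋ ∑ (words N) (f ∘ (_∷ʳ 0F)) + ∑ (words N) (f ∘ (_∷ʳ 1F))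
-- In a word of length one the first letter is the last.
∑-words-∷ʳ zero    f = ∑-words-∷ zero f
∑-words-∷ʳ (suc N) f = begin
  ∑ (words (suc (suc N))) f                   ≈⟨ ∑-words-∷ (suc N) f ⟩
  ∑ (words (suc N)) f₀ + ∑ (words (suc N)) f₁ ≈⟨ +-cong (∑-words-∷ʳ N f₀) (∑-words-∷ʳ N f₁) ⟩
  (s f₀ 0F + s f₀ 1F) + (s f₁ 0F + s f₁ 1F)   ≈⟨ interchange (s f₀ 0F) (s f₀ 1F) (s f₁ 0F) (s f₁ 1F) ⟩
  (s f₀ 0F + s f₁ 0F) + (s f₀ 1F + s f₁ 1F)   ≈⟨ +-cong (∑-words-∷ N (f ∘ (_∷ʳ 0F))) (∑-words-∷ N (f ∘ (_∷ʳ 1F))) ⟨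
  ∑ (words (suc N)) (f ∘ (_∷ʳ 0F)) + ∑ (words (suc N)) (f ∘ (_∷ʳ 1F)) ∎
  where
  open ≈-Reasoning
  f₀ = f ∘ (0F ∷_)
  f₁ = f ∘ (1F ∷_)
  s : (Word (suc N) → Poly) → Fin 2 → Poly
  s g x = ∑ (words N) (g ∘ (_∷ʳ x))

-- Sums over the words with given numbers of ones and zeros

∑ᶜ : ∀ N (a b : ℕ) → (Word N → Poly) → Poly
∑ᶜ N a b f = ∑ (words N) λ w → guard (hasContent? a b w) (f w)

-- What a sum over content `a`, `b` becomes once one 0, respectively one 1, is removed from each
-- word. The value `0#` covers contents that have no such letter to remove.
∑ᶜ₀ ∑ᶜ₁ : ∀ N (a b : ℕ) → (Word N → Poly) → Poly
∑ᶜ₀ N a zero    f = 0#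
∑ᶜ₀ N a (suc b) f = ∑ᶜ N a b f
∑ᶜ₁ N zero    b f = 0#
∑ᶜ₁ N (suc a) b f = ∑ᶜ N a b f

∑ᶜ-cong : ∀ {N a b f g} → (∀ w → HasContent a b w → f w ≋ g w) → ∑ᶜ N a b f ≋ ∑ᶜ N a b g
∑ᶜ-cong {N} {a} {b} f≋g = ∑-cong (words N) λ w → guard-cong (hasContent? a b w) (f≋g w)

∑ᶜ-*ˡ : ∀ p N a b f → ∑ᶜ N a b (λ w → p * f w) ≋ p * ∑ᶜ N a b f
∑ᶜ-*ˡ p N a b f = ≋-trans
  (∑-cong (words N) λ w → guard-*ˡ (hasContent? a b w) p (f w))
  (∑-*ˡ p (words N) λ w → guard (hasContent? a b w) (f w))

∑ᶜ-q^ : ∀ {N a b} k (f g : Word N → ℕ) → (∀ w → HasContent a b w → f w ≡ k ℕ.+ g w) →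
  ∑ᶜ N a b (q^_ ∘ f) ≋ q^ k * ∑ᶜ N a b (q^_ ∘ g)
∑ᶜ-q^ {N} {a} {b} k f g f≡k+g = ≋-trans
  (∑ᶜ-cong {N} {a} {b} {q^_ ∘ f} λ w h → ≋-trans (≡⇒≋ (cong q^_ (f≡k+g w h))) (q^-+ k (g w)))
  (∑ᶜ-*ˡ (q^ k) N a b (q^_ ∘ g))

∑ᶜ-≡ : ∀ {N a b f g} → (∀ w → HasContent a b w → f w ≡ g w) → ∑ᶜ N a b f ≋ ∑ᶜ N a b g
∑ᶜ-≡ {N} {a} {b} f≡g = ∑ᶜ-cong {N} {a} {b} λ w h → ≡⇒≋ (f≡g w h)

∑ᶜ-zero : ∀ {N a b f} → (∀ w → HasContent a b w → f w ≡ 0#) → ∑ᶜ N a b f ≋ 0#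
∑ᶜ-zero {N} {a} {b} f≡0 = ≋-trans
  (∑-cong (words N) λ w → guard-0 (hasContent? a b w) (f≡0 w))
  (∑-zero (words N))
  where
  guard-0 : ∀ {P : Set} (P? : Dec P) {p} → (P → p ≡ 0#) → guard P? p ≋ 0#
  guard-0 (yes h) p≡0 = ≡⇒≋ (p≡0 h)
  guard-0 (no _)  p≡0 = ≋-refl

module _ {N : ℕ} (ins : Word N → Word (suc N)) where

  -- Only the effect of `ins` on the letter counts matters, so one argument serves for prepending
  -- and for appending a letter.
  ∑ᶜ-insert₀ : (∀ w → #ones (ins w) ≡ #ones w) → (∀ w → #zeros (ins w) ≡ suc (#zeros w)) →
    ∀ a b f → ∑ (words N) (λ w → guard (hasContent? a b (ins w)) (f (ins w))) ≋ ∑ᶜ₀ N a b (f ∘ ins)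
  ∑ᶜ-insert₀ ones zeros a zero f = ≋-trans
    (∑-cong (words N) λ w → ≡⇒≋ (guard-no (hasContent? a 0 (ins w)) λ h →
      ℕ.1+n≢0 (trans (sym (zeros w)) (proj₂ h))))
    (∑-zero (words N))
  ∑ᶜ-insert₀ ones zeros a (suc b) f =
    ∑-cong (words N) λ w → ≡⇒≋ (guard-⇔ (hasContent? a (suc b) (ins w)) (hasContent? a b w)
      (mk⇔ (λ (h , k) → trans (sym (ones w)) h , ℕ.suc-injective (trans (sym (zeros w)) k))
           (λ (h , k) → trans (ones w) h , trans (zeros w) (cong suc k))))

  ∑ᶜ-insert₁ : (∀ w → #ones (ins w) ≡ suc (#ones w)) → (∀ w → #zeros (ins w) ≡ #zeros w) →
    ∀ a b f → ∑ (words N) (λ w → guard (hasContent? a b (ins w)) (f (ins w))) ≋ ∑ᶜ₁ N a b (f ∘ ins)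
  ∑ᶜ-insert₁ ones zeros zero b f = ≋-trans
    (∑-cong (words N) λ w → ≡⇒≋ (guard-no (hasContent? 0 b (ins w)) λ h →
      ℕ.1+n≢0 (trans (sym (ones w)) (proj₁ h))))
    (∑-zero (words N))
  ∑ᶜ-insert₁ ones zeros (suc a) b f =
    ∑-cong (words N) λ w → ≡⇒≋ (guard-⇔ (hasContent? (suc a) b (ins w)) (hasContent? a b w)
      (mk⇔ (λ (h , k) → ℕ.suc-injective (trans (sym (ones w)) h) , trans (sym (zeros w)) k)
           (λ (h , k) → trans (ones w) (cong suc h) , trans (zeros w) k)))

#ones-∷ʳ0 : ∀ {N} (w : Word N) → #ones (w ∷ʳ 0F) ≡ #ones w
#ones-∷ʳ0 []       = refl
#ones-∷ʳ0 (0F ∷ w) = #ones-∷ʳ0 w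
#ones-∷ʳ0 (1F ∷ w) = cong suc (#ones-∷ʳ0 w)

#ones-∷ʳ1 : ∀ {N} (w : Word N) → #ones (w ∷ʳ 1F) ≡ suc (#ones w)
#ones-∷ʳ1 []       = refl
#ones-∷ʳ1 (0F ∷ w) = #ones-∷ʳ1 w
#ones-∷ʳ1 (1F ∷ w) = cong suc (#ones-∷ʳ1 w)

#zeros-∷ʳ0 : ∀ {N} (w : Word N) → #zeros (w ∷ʳ 0F) ≡ suc (#zeros w)
#zeros-∷ʳ0 []       = refl
#zeros-∷ʳ0 (0F ∷ w) = cong suc (#zeros-∷ʳ0 w)
#zeros-∷ʳ0 (1F ∷ w) = #zeros-∷ʳ0 w

#zeros-∷ʳ1 : ∀ {N} (w : Word N) → #zeros (w ∷ʳ 1F) ≡ #zeros w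
#zeros-∷ʳ1 []       = refl
#zeros-∷ʳ1 (0F ∷ w) = cong suc (#zeros-∷ʳ1 w)
#zeros-∷ʳ1 (1F ∷ w) = #zeros-∷ʳ1 w

∑ᶜ-∷ : ∀ N a b f →
  ∑ᶜ (suc N) a b f ≋ ∑ᶜ₀ N a b (f ∘ (0F ∷_)) + ∑ᶜ₁ N a b (f ∘ (1F ∷_))
∑ᶜ-∷ N a b f = ≋-trans (∑-words-∷ N _)
  (+-cong (∑ᶜ-insert₀ (0F ∷_) (λ _ → refl) (λ _ → refl) a b f)
          (∑ᶜ-insert₁ (1F ∷_) (λ _ → refl) (λ _ → refl) a b f))

∑ᶜ-∷ʳ : ∀ N a b f →
  ∑ᶜ (suc N) a b f ≋ ∑ᶜ₀ N a b (f ∘ (_∷ʳ 0F)) + ∑ᶜ₁ N a b (f ∘ (_∷ʳ 1F))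
∑ᶜ-∷ʳ N a b f = ≋-trans (∑-words-∷ʳ N _)
  (+-cong (∑ᶜ-insert₀ (_∷ʳ 0F) #ones-∷ʳ0 #zeros-∷ʳ0 a b f)
          (∑ᶜ-insert₁ (_∷ʳ 1F) #ones-∷ʳ1 #zeros-∷ʳ1 a b f))

-- Recursions for the statistics

module _ {A : Set} {P : Pred A 0ℓ} (P? : Decidable P) where

  sum-filter : ∀ (f : A → ℕ) xs →
    sum (List.map f (filter P? xs)) ≡ sum (List.map (λ x → if does (P? x) then f x else 0) xs)
  sum-filter f []       = refl
  sum-filter f (x ∷ xs) with does (P? x)
  ... | true  = cong (f x ℕ.+_) (sum-filter f xs)
  ... | false = sum-filter f xs

  length-filter-cong : ∀ {Q : Pred A 0ℓ} (Q? : Decidable Q) → (∀ x → does (P? x) ≡ does (Q? x)) →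
    ∀ xs → length (filter P? xs) ≡ length (filter Q? xs)
  length-filter-cong Q? eq []       = refl
  length-filter-cong Q? eq (x ∷ xs) with does (P? x) | does (Q? x) | eq x
  ... | true  | true  | refl = cong suc (length-filter-cong Q? eq xs)
  ... | false | false | refl = length-filter-cong Q? eq xs

  length-filter-map : ∀ {B : Set} (g : B → A) xs →
    length (filter P? (List.map g xs)) ≡ length (filter (P? ∘ g) xs)
  length-filter-map g []       = refl
  length-filter-map g (x ∷ xs) with does (P? (g x))
  ... | true  = cong suc (length-filter-map g xs)
  ... | false = length-filter-map g xs

length-filter-cartesianProduct : ∀ {A B : Set} {P : Pred (A × B) 0ℓ} (P? : Decidable P) xs ys →
  length (filter P? (cartesianProduct xs ys))
    ≡ sum (List.map (λ x → length (filter (P? ∘ (x ,_)) ys)) xs)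
length-filter-cartesianProduct P? []       ys = refl
length-filter-cartesianProduct P? (x ∷ xs) ys = begin
  length (filter P? (row ++ rows))                     ≡⟨ cong length (List.filter-++ P? row rows) ⟩
  length (filter P? row ++ filter P? rows)             ≡⟨ List.length-++ (filter P? row) ⟩
  length (filter P? row) ℕ.+ length (filter P? rows)
    ≡⟨ cong₂ ℕ._+_ (length-filter-map P? (x ,_) ys) (length-filter-cartesianProduct P? xs ys) ⟩
  sum (List.map (λ x → length (filter (P? ∘ (x ,_)) ys)) (x ∷ xs))  ∎
  where
  open ≡-Reasoning
  row  = List.map (x ,_) ys
  rows = cartesianProduct xs ys

allFin-suc : ∀ N → allFin (suc N) ≡ zero ∷ List.map suc (allFin N)
allFin-suc N = cong (zero ∷_) (sym (List.map-tabulate (λ i → i) suc))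

length-filter-lookup : ∀ {A : Set} {P : Pred A 0ℓ} (P? : Decidable P) {N} (v : Vec A N) →
  length (filter (P? ∘ lookup v) (allFin N)) ≡ count P? v
length-filter-lookup P? []              = refl
length-filter-lookup P? {suc N} (x ∷ v) = trans
  (cong (length ∘ filter (P? ∘ lookup (x ∷ v))) (allFin-suc N)) step
  where
  rec : length (filter (P? ∘ lookup (x ∷ v)) (List.map suc (allFin N))) ≡ count P? v
  rec = trans (length-filter-map (P? ∘ lookup (x ∷ v)) suc (allFin N)) (length-filter-lookup P? v)
  step : length (filter (P? ∘ lookup (x ∷ v)) (zero ∷ List.map suc (allFin N))) ≡ count P? (x ∷ v)
  step with does (P? x)
  ... | true  = cong suc rec
  ... | false = rec

#below : ∀ {N} → Fin 2 → Word N → ℕ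
#below x = count (Fin._<? x)

-- The pairs are sorted by their first index: those starting at `zero` count the later letters below
-- `x`, the others are the inversions of `w`.
inv-∷ : ∀ {N} x (w : Word N) → inv (x ∷ w) ≡ #below x w ℕ.+ inv w
inv-∷ {N} x w = begin
  inv (x ∷ w)
    ≡⟨ cong (λ l → length (filter (inversion? (x ∷ w)) (cartesianProduct l l))) (allFin-suc N) ⟩
  length (filter (inversion? (x ∷ w)) (cartesianProduct (zero ∷ l) (zero ∷ l)))
    ≡⟨ length-filter-cartesianProduct (inversion? (x ∷ w)) (zero ∷ l) (zero ∷ l) ⟩
  length (filter (inversion? (x ∷ w) ∘ (zero ,_)) l) ℕ.+ sum (List.map row l)
    ≡⟨ cong₂ ℕ._+_ first rest ⟩
  #below x w ℕ.+ inv w ∎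
  where
  open ≡-Reasoning
  l : List (Fin (suc N))
  l = List.map suc (allFin N)
  row : Fin (suc N) → ℕ
  row i = length (filter (inversion? (x ∷ w) ∘ (i ,_)) (zero ∷ l))
  -- `zero` < `suc j` decides to `true`, so the conjunction in `inversion?` has the boolean of its
  -- second half.
  first : length (filter (inversion? (x ∷ w) ∘ (zero ,_)) l) ≡ #below x w
  first = trans (length-filter-map (inversion? (x ∷ w) ∘ (zero ,_)) suc (allFin N))
         (trans (length-filter-cong _ ((Fin._<? x) ∘ lookup w) (λ _ → refl) (allFin N))
                (length-filter-lookup (Fin._<? x) w))
  -- The pair of `suc i` and `zero` is filtered out by computation, since `suc i` < `zero` decides
  -- to `false`.
  row-suc : ∀ i → row (suc i) ≡ length (filter (inversion? w ∘ (i ,_)) (allFin N))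
  row-suc i = trans (length-filter-map (inversion? (x ∷ w) ∘ (suc i ,_)) suc (allFin N))
                    (length-filter-cong _ (inversion? w ∘ (i ,_)) (λ _ → refl) (allFin N))
  rest : sum (List.map row l) ≡ inv w
  rest = trans (cong sum (trans (sym (List.map-∘ (allFin N))) (List.map-cong row-suc (allFin N))))
               (sym (length-filter-cartesianProduct (inversion? w) (allFin N) (allFin N)))

inv-0∷ : ∀ {N} (w : Word N) → inv (0F ∷ w) ≡ inv w
inv-0∷ w = trans (inv-∷ 0F w) (cong (ℕ._+ inv w) (none w))
  where
  none : ∀ {N} (w : Word N) → #below 0F w ≡ 0
  none []       = refl
  none (0F ∷ w) = none w
  none (1F ∷ w) = none w

inv-1∷ : ∀ {N} (w : Word N) → inv (1F ∷ w) ≡ #zeros w ℕ.+ inv w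
inv-1∷ w = trans (inv-∷ 1F w) (cong (ℕ._+ inv w) (zeros w))
  where
  zeros : ∀ {N} (w : Word N) → #below 1F w ≡ #zeros w
  zeros []       = refl
  zeros (0F ∷ w) = cong suc (zeros w)
  zeros (1F ∷ w) = zeros w

-- A final 0 forms an inversion with every 1 before it.
inv-∷ʳ0 : ∀ {N} (w : Word N) → inv (w ∷ʳ 0F) ≡ #ones w ℕ.+ inv w
inv-∷ʳ0 []       = refl
inv-∷ʳ0 (0F ∷ w) = trans (inv-0∷ (w ∷ʳ 0F)) (trans (inv-∷ʳ0 w) (cong (#ones w ℕ.+_) (sym (inv-0∷ w))))
inv-∷ʳ0 (1F ∷ w) = begin
  inv (1F ∷ (w ∷ʳ 0F))                            ≡⟨ inv-1∷ (w ∷ʳ 0F) ⟩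
  #zeros (w ∷ʳ 0F) ℕ.+ inv (w ∷ʳ 0F)              ≡⟨ cong₂ ℕ._+_ (#zeros-∷ʳ0 w) (inv-∷ʳ0 w) ⟩
  suc (#zeros w ℕ.+ (#ones w ℕ.+ inv w))          ≡⟨ cong suc (x∙yz≈y∙xz (#zeros w) (#ones w) (inv w)) ⟩
  suc (#ones w ℕ.+ (#zeros w ℕ.+ inv w))          ≡⟨ cong (λ k → suc (#ones w ℕ.+ k)) (inv-1∷ w) ⟨
  suc (#ones w) ℕ.+ inv (1F ∷ w)                  ∎
  where open ≡-Reasoning

inv-∷ʳ1 : ∀ {N} (w : Word N) → inv (w ∷ʳ 1F) ≡ inv w
inv-∷ʳ1 []       = refl
inv-∷ʳ1 (0F ∷ w) = trans (inv-0∷ (w ∷ʳ 1F)) (trans (inv-∷ʳ1 w) (sym (inv-0∷ w)))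
inv-∷ʳ1 (1F ∷ w) = trans (inv-1∷ (w ∷ʳ 1F))
  (trans (cong₂ ℕ._+_ (#zeros-∷ʳ1 w) (inv-∷ʳ1 w)) (sym (inv-1∷ w)))

-- The contribution to maj of a suffix w whose first letter has 1-based index
-- suc i and is preceded by the letter x.
majFrom : ∀ {N} → ℕ → Fin 2 → Word N → ℕ
majFrom i x []      = 0
majFrom i x (y ∷ w) = (if does (y Fin.<? x) then i else 0) ℕ.+ majFrom (suc i) y w

-- Agrees with maj on nonempty words: a letter 0 put in front creates no descent.
maj₀ : ∀ {N} → Word N → ℕ
maj₀ = majFrom 0 0F

-- The offset, 1 in `maj`, is generalised to `i` because passing to the tail raises every index by
-- one.
maj-∷ : ∀ {N} i x (w : Word N) →
  sum (List.map ((i ℕ.+_) ∘ toℕ) (filter (descent? (x ∷ w)) (allFin N))) ≡ majFrom i x w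
maj-∷         i x []      = refl
maj-∷ {suc N} i x (y ∷ w) = begin
  sum (List.map ((i ℕ.+_) ∘ toℕ) (filter D? (allFin (suc N))))
    ≡⟨ cong (sum ∘ List.map ((i ℕ.+_) ∘ toℕ) ∘ filter D?) (allFin-suc N) ⟩
  sum (List.map ((i ℕ.+_) ∘ toℕ) (filter D? (zero ∷ List.map suc (allFin N))))
    ≡⟨ sum-filter D? ((i ℕ.+_) ∘ toℕ) (zero ∷ List.map suc (allFin N)) ⟩
  (if does (y Fin.<? x) then i ℕ.+ 0 else 0) ℕ.+ sum (List.map weight (List.map suc (allFin N)))
    ≡⟨ cong₂ ℕ._+_ (cong (if does (y Fin.<? x) then_else 0) (ℕ.+-identityʳ i)) rest ⟩
  majFrom i x (y ∷ w) ∎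
  where
  open ≡-Reasoning
  D? = descent? (x ∷ y ∷ w)
  weight : Fin (suc N) → ℕ
  weight j = if does (D? j) then i ℕ.+ toℕ j else 0
  rest : sum (List.map weight (List.map suc (allFin N))) ≡ majFrom (suc i) y w
  rest = begin
    sum (List.map weight (List.map suc (allFin N)))
      ≡⟨ cong sum (List.map-∘ (allFin N)) ⟨
    sum (List.map (weight ∘ suc) (allFin N))
      ≡⟨ cong sum (List.map-cong (λ j → cong (if does (D? (suc j)) then_else 0) (ℕ.+-suc i (toℕ j))) (allFin N)) ⟩
    sum (List.map (λ j → if does (descent? (y ∷ w) j) then suc i ℕ.+ toℕ j else 0) (allFin N))
      ≡⟨ sum-filter (descent? (y ∷ w)) ((suc i ℕ.+_) ∘ toℕ) (allFin N) ⟨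
    sum (List.map ((suc i ℕ.+_) ∘ toℕ) (filter (descent? (y ∷ w)) (allFin N)))
      ≡⟨ maj-∷ (suc i) y w ⟩
    majFrom (suc i) y w ∎

maj≡maj₀ : ∀ {N} (w : Word (suc N)) → maj w ≡ maj₀ w
maj≡maj₀ (0F ∷ w) = maj-∷ 1 0F w
maj≡maj₀ (1F ∷ w) = maj-∷ 1 1F w

-- A final 1 is never below its predecessor. The cases on `x` let that comparison compute.
majFrom-∷ʳ1 : ∀ {N} i x (w : Word N) → majFrom i x (w ∷ʳ 1F) ≡ majFrom i x w
majFrom-∷ʳ1 i 0F []      = refl
majFrom-∷ʳ1 i 1F []      = refl
majFrom-∷ʳ1 i x  (y ∷ w) = cong ((if does (y Fin.<? x) then i else 0) ℕ.+_) (majFrom-∷ʳ1 (suc i) y w)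

majFrom-∷ʳ00 : ∀ {N} i x (w : Word N) → majFrom i x (w ∷ʳ 0F ∷ʳ 0F) ≡ majFrom i x (w ∷ʳ 0F)
majFrom-∷ʳ00 i x []      = refl
majFrom-∷ʳ00 i x (y ∷ w) = cong ((if does (y Fin.<? x) then i else 0) ℕ.+_) (majFrom-∷ʳ00 (suc i) y w)

-- The appended 1 ends no descent and starts one, whose weight is the index of that 1: the letters
-- of `w` have indices from `suc i` on, so the 1 has index `suc i ℕ.+ N`.
majFrom-∷ʳ10 : ∀ {N} i x (w : Word N) → majFrom i x (w ∷ʳ 1F ∷ʳ 0F) ≡ suc i ℕ.+ N ℕ.+ majFrom i x w
majFrom-∷ʳ10 i 0F [] = cong suc (sym (ℕ.+-identityʳ (i ℕ.+ 0)))
majFrom-∷ʳ10 i 1F [] = cong suc (sym (ℕ.+-identityʳ (i ℕ.+ 0)))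
majFrom-∷ʳ10 {suc N} i x (y ∷ w) = begin
  d ℕ.+ majFrom (suc i) y (w ∷ʳ 1F ∷ʳ 0F)         ≡⟨ cong (d ℕ.+_) (majFrom-∷ʳ10 (suc i) y w) ⟩
  d ℕ.+ (suc (suc i) ℕ.+ N ℕ.+ majFrom (suc i) y w) ≡⟨ x∙yz≈y∙xz d (suc (suc i) ℕ.+ N) _ ⟩
  suc (suc i) ℕ.+ N ℕ.+ majFrom i x (y ∷ w)       ≡⟨ cong (λ k → suc k ℕ.+ majFrom i x (y ∷ w)) (ℕ.+-suc i N) ⟨
  suc i ℕ.+ suc N ℕ.+ majFrom i x (y ∷ w)         ∎
  where
  open ≡-Reasoning
  d = if does (y Fin.<? x) then i else 0

-- The generating functions

-- Split by the first letter: a leading 0 adds nothing and a leading 1 adds one inversion per zero.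
-- This is the recursion that defines `qbinom`.
∑-inv : ∀ N a b → a ℕ.+ b ≡ N → ∑ᶜ N a b (q^_ ∘ inv) ≋ qbinom a b
∑-inv zero    zero    zero    _  = ≋-refl
∑-inv (suc N) a       b       eq = begin
  ∑ᶜ (suc N) a b (q^_ ∘ inv)                    ≈⟨ ∑ᶜ-∷ N a b (q^_ ∘ inv) ⟩
  ∑ᶜ₀ N a b (q^_ ∘ inv ∘ (0F ∷_)) + ∑ᶜ₁ N a b (q^_ ∘ inv ∘ (1F ∷_))  ≈⟨ cases a b eq ⟩
  qbinom a b                                    ∎
  where
  open ≈-Reasoning
  first₀ : ∀ a b → a ℕ.+ b ≡ N → ∑ᶜ N a b (q^_ ∘ inv ∘ (0F ∷_)) ≋ qbinom a b
  first₀ a b eq = ≋-trans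
    (∑ᶜ-≡ {N} {a} {b} λ w _ → cong q^_ (inv-0∷ w))
    (∑-inv N a b eq)
  first₁ : ∀ a b → a ℕ.+ b ≡ N → ∑ᶜ N a b (q^_ ∘ inv ∘ (1F ∷_)) ≋ q^ b * qbinom a b
  first₁ a b eq = ≋-trans
    (∑ᶜ-q^ {N} {a} {b} b (inv ∘ (1F ∷_)) inv
      λ w h → trans (inv-1∷ w) (cong (ℕ._+ inv w) (proj₂ h)))
    (*-congˡ (q^ b) (∑-inv N a b eq))
  cases : ∀ a b → a ℕ.+ b ≡ suc N →
    ∑ᶜ₀ N a b (q^_ ∘ inv ∘ (0F ∷_)) + ∑ᶜ₁ N a b (q^_ ∘ inv ∘ (1F ∷_)) ≋ qbinom a b
  cases zero    (suc b) eq = ≋-trans (+-identityʳ _) (first₀ 0 b (ℕ.suc-injective eq))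
  cases (suc a) zero    eq = ≋-trans (first₁ a 0 (ℕ.suc-injective eq))
    (≋-trans (*-identityˡ (qbinom a 0)) (≡⇒≋ (qbinom-zeroʳ a)))
  cases (suc a) (suc b) eq = +-cong
    (first₀ (suc a) b (trans (sym (ℕ.+-suc a b)) (ℕ.suc-injective eq)))
    (first₁ a (suc b) (ℕ.suc-injective eq))

∑-inv-∷ʳ0 : ∀ N a b → a ℕ.+ b ≡ N → ∑ᶜ N a b (q^_ ∘ inv ∘ (_∷ʳ 0F)) ≋ q^ a * qbinom a b
∑-inv-∷ʳ0 N a b eq = ≋-trans
  (∑ᶜ-q^ {N} {a} {b} a (inv ∘ (_∷ʳ 0F)) inv
    λ w h → trans (inv-∷ʳ0 w) (cong (ℕ._+ inv w) (proj₁ h)))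
  (*-congˡ (q^ a) (∑-inv N a b eq))

∑-inv-∷ʳ1 : ∀ N a b → a ℕ.+ b ≡ N → ∑ᶜ N a b (q^_ ∘ inv ∘ (_∷ʳ 1F)) ≋ qbinom a b
∑-inv-∷ʳ1 N a b eq = ≋-trans
  (∑ᶜ-≡ {N} {a} {b} λ w _ → cong q^_ (inv-∷ʳ1 w))
  (∑-inv N a b eq)

-- The second q-Pascal rule, obtained by counting the same inversions by the last letter instead of
-- the first.
qbinom-pascal′ : ∀ a b →
  qbinom (suc a) (suc b) ≋ q^ suc a * qbinom (suc a) b + qbinom a (suc b)
qbinom-pascal′ a b = begin
  qbinom (suc a) (suc b)                               ≈⟨ ∑-inv (suc N) (suc a) (suc b) refl ⟨
  ∑ᶜ (suc N) (suc a) (suc b) (q^_ ∘ inv)               ≈⟨ ∑ᶜ-∷ʳ N (suc a) (suc b) (q^_ ∘ inv) ⟩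
  ∑ᶜ N (suc a) b (q^_ ∘ inv ∘ (_∷ʳ 0F)) + ∑ᶜ N a (suc b) (q^_ ∘ inv ∘ (_∷ʳ 1F))
    ≈⟨ +-cong (∑-inv-∷ʳ0 N (suc a) b (sym (ℕ.+-suc a b))) (∑-inv-∷ʳ1 N a (suc b) refl) ⟩
  q^ suc a * qbinom (suc a) b + qbinom a (suc b)       ∎
  where
  open ≈-Reasoning
  N = a ℕ.+ suc b

mutual
  -- Split by the last letter. A final 1 keeps maj, but the effect of a final 0 depends on the
  -- letter before it, so those words have their own statement. The two parts add up by
  -- `qbinom-pascal′`.
  ∑-maj : ∀ N a b → a ℕ.+ b ≡ N → ∑ᶜ N a b (q^_ ∘ maj₀) ≋ qbinom a b
  ∑-maj zero    zero zero _  = ≋-refl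
  ∑-maj (suc N) a    b    eq = ≋-trans (∑ᶜ-∷ʳ N a b (q^_ ∘ maj₀)) (cases a b eq)
    where
    last₁ : ∀ a b → a ℕ.+ b ≡ N → ∑ᶜ N a b (q^_ ∘ maj₀ ∘ (_∷ʳ 1F)) ≋ qbinom a b
    last₁ a b eq = ≋-trans
      (∑ᶜ-≡ {N} {a} {b} λ w _ → cong q^_ (majFrom-∷ʳ1 0 0F w))
      (∑-maj N a b eq)
    cases : ∀ a b → a ℕ.+ b ≡ suc N →
      ∑ᶜ₀ N a b (q^_ ∘ maj₀ ∘ (_∷ʳ 0F)) + ∑ᶜ₁ N a b (q^_ ∘ maj₀ ∘ (_∷ʳ 1F)) ≋ qbinom a b
    cases zero    (suc b) eq = ≋-trans (+-identityʳ _)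
      (≋-trans (∑-maj-∷ʳ0 N 0 b (ℕ.suc-injective eq)) (*-identityˡ 1#))
    cases (suc a) zero    eq = ≋-trans (last₁ a 0 (ℕ.suc-injective eq)) (≡⇒≋ (qbinom-zeroʳ a))
    cases (suc a) (suc b) eq = ≋-trans
      (+-cong (∑-maj-∷ʳ0 N (suc a) b (trans (sym (ℕ.+-suc a b)) (ℕ.suc-injective eq)))
              (last₁ a (suc b) (ℕ.suc-injective eq)))
      (≋-sym (qbinom-pascal′ a b))

  ∑-maj-∷ʳ0 : ∀ N a b → a ℕ.+ b ≡ N →
    ∑ᶜ N a b (q^_ ∘ maj₀ ∘ (_∷ʳ 0F)) ≋ q^ a * qbinom a b
  ∑-maj-∷ʳ0 zero    zero zero _  = ≋-refl
  ∑-maj-∷ʳ0 (suc N) a    b    eq = ≋-trans (∑ᶜ-∷ʳ N a b (q^_ ∘ maj₀ ∘ (_∷ʳ 0F))) (cases a b eq)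
    where
    open ≈-Reasoning
    last₀₀ : ∀ a b → a ℕ.+ b ≡ N → ∑ᶜ N a b (λ w → q^ maj₀ (w ∷ʳ 0F ∷ʳ 0F)) ≋ q^ a * qbinom a b
    last₀₀ a b eq = ≋-trans
      (∑ᶜ-≡ {N} {a} {b} λ w _ → cong q^_ (majFrom-∷ʳ00 0 0F w))
      (∑-maj-∷ʳ0 N a b eq)
    last₁₀ : ∀ a b → a ℕ.+ b ≡ N →
      ∑ᶜ N a b (λ w → q^ maj₀ (w ∷ʳ 1F ∷ʳ 0F)) ≋ q^ (suc a ℕ.+ b) * qbinom a b
    last₁₀ a b eq = ≋-trans
      (∑ᶜ-q^ {N} {a} {b} (suc a ℕ.+ b) (λ w → maj₀ (w ∷ʳ 1F ∷ʳ 0F)) maj₀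
        λ w _ → trans (majFrom-∷ʳ10 0 0F w) (cong (λ k → suc k ℕ.+ maj₀ w) (sym eq)))
      (*-congˡ (q^ (suc a ℕ.+ b)) (∑-maj N a b eq))
    cases : ∀ a b → a ℕ.+ b ≡ suc N →
      ∑ᶜ₀ N a b (λ w → q^ maj₀ (w ∷ʳ 0F ∷ʳ 0F)) + ∑ᶜ₁ N a b (λ w → q^ maj₀ (w ∷ʳ 1F ∷ʳ 0F))
        ≋ q^ a * qbinom a b
    cases zero    (suc b) eq = ≋-trans (+-identityʳ _) (last₀₀ 0 b (ℕ.suc-injective eq))
    cases (suc a) zero    eq = ≋-trans (last₁₀ a 0 (ℕ.suc-injective eq))
      (≡⇒≋ (cong₂ (λ k p → q^ suc k * p) (ℕ.+-identityʳ a) (qbinom-zeroʳ a)))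
    cases (suc a) (suc b) eq = begin
      ∑ᶜ N (suc a) b _ + ∑ᶜ N a (suc b) _
        ≈⟨ +-cong (last₀₀ (suc a) b (trans (sym (ℕ.+-suc a b)) (ℕ.suc-injective eq)))
                  (last₁₀ a (suc b) (ℕ.suc-injective eq)) ⟩
      x * u + q^ (suc a ℕ.+ suc b) * v    ≈⟨ +-congˡ (x * u) (*-congʳ v (q^-+ (suc a) (suc b))) ⟩
      x * u + x * y * v                   ≈⟨ factor x y u v ⟩
      x * (u + y * v)                     ∎
      where
      x = q^ suc a
      y = q^ suc b
      u = qbinom (suc a) b
      v = qbinom a (suc b)
      factor : ∀ x y u v → x * u + x * y * v ≋ x * (u + y * v)
      factor = solve-∀ ring

-- The condition on the last zero

LastZeroCond : ∀ {N} → Pred (Word N) 0ℓ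
LastZeroCond w = ∀ t → IsLastZero w t →
  toℕ t ≡ 0 ⊎ ∃[ s ] (suc (toℕ s) ≡ toℕ t × lookup w s ≡ 0F)

lastZeroCond? : ∀ {N} → Decidable (LastZeroCond {N})
lastZeroCond? w = Fin.all? λ t → isLastZero? w t →-dec
  ((toℕ t ℕ.≟ 0) ⊎-dec Fin.any? λ s → (suc (toℕ s) ℕ.≟ toℕ t) ×-dec (lookup w s Fin.≟ 0F))

lookup-∷ʳ-inject₁ : ∀ {A : Set} {N} (v : Vec A N) x i → lookup (v ∷ʳ x) (inject₁ i) ≡ lookup v i
lookup-∷ʳ-inject₁ (y ∷ v) x zero    = refl
lookup-∷ʳ-inject₁ (y ∷ v) x (suc i) = lookup-∷ʳ-inject₁ v x i

lookup-∷ʳ-fromℕ : ∀ {A : Set} {N} (v : Vec A N) x → lookup (v ∷ʳ x) (fromℕ N) ≡ x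
lookup-∷ʳ-fromℕ []      x = refl
lookup-∷ʳ-fromℕ (y ∷ v) x = lookup-∷ʳ-fromℕ v x

0F≢1F : ∀ {x : Fin 2} → x ≡ 0F → ¬ x ≡ 1F
0F≢1F refl ()

module _ {N} (w : Word N) where

  lastZero-∷ʳ1⁺ : ∀ {t} → IsLastZero w t → IsLastZero (w ∷ʳ 1F) (inject₁ t)
  lastZero-∷ʳ1⁺ {t} (w[t]≡0 , isLast) = trans (lookup-∷ʳ-inject₁ w 1F t) w[t]≡0 , last′
    where
    last′ : ∀ i → lookup (w ∷ʳ 1F) i ≡ 0F → i Fin.≤ inject₁ t
    last′ i w[i]≡0 with view i
    ... | ‵fromℕ     = contradiction (lookup-∷ʳ-fromℕ w 1F) (0F≢1F w[i]≡0)
    ... | ‵inject₁ j = subst₂ ℕ._≤_ (sym (Fin.toℕ-inject₁ j)) (sym (Fin.toℕ-inject₁ t))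
      (isLast j (trans (sym (lookup-∷ʳ-inject₁ w 1F j)) w[i]≡0))

  lastZero-∷ʳ1⁻ : ∀ {t} → IsLastZero (w ∷ʳ 1F) (inject₁ t) → IsLastZero w t
  lastZero-∷ʳ1⁻ {t} (w[t]≡0 , isLast) =
    trans (sym (lookup-∷ʳ-inject₁ w 1F t)) w[t]≡0 ,
    λ j w[j]≡0 → subst₂ ℕ._≤_ (Fin.toℕ-inject₁ j) (Fin.toℕ-inject₁ t)
      (isLast (inject₁ j) (trans (lookup-∷ʳ-inject₁ w 1F j) w[j]≡0))

  -- The appended 1 is neither the last zero nor a zero just before it, so every position that the
  -- condition mentions lies in `w`.
  lastZeroCond-∷ʳ1 : LastZeroCond (w ∷ʳ 1F) ⇔ LastZeroCond w
  lastZeroCond-∷ʳ1 = mk⇔ to from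
    where
    to : LastZeroCond (w ∷ʳ 1F) → LastZeroCond w
    to cond t isLast with cond (inject₁ t) (lastZero-∷ʳ1⁺ isLast)
    ... | inj₁ t≡0 = inj₁ (trans (sym (Fin.toℕ-inject₁ t)) t≡0)
    ... | inj₂ (s , 1+s≡t , w[s]≡0) with view s
    ...   | ‵fromℕ     = contradiction (lookup-∷ʳ-fromℕ w 1F) (0F≢1F w[s]≡0)
    ...   | ‵inject₁ r = inj₂ (r
      , trans (cong suc (sym (Fin.toℕ-inject₁ r))) (trans 1+s≡t (Fin.toℕ-inject₁ t))
      , trans (sym (lookup-∷ʳ-inject₁ w 1F r)) w[s]≡0)
    from : LastZeroCond w → LastZeroCond (w ∷ʳ 1F)
    from cond t isLast with view t
    ... | ‵fromℕ     = contradiction (lookup-∷ʳ-fromℕ w 1F) (0F≢1F (proj₁ isLast))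
    ... | ‵inject₁ r with cond r (lastZero-∷ʳ1⁻ isLast)
    ...   | inj₁ r≡0                  = inj₁ (trans (Fin.toℕ-inject₁ r) r≡0)
    ...   | inj₂ (s , 1+s≡r , w[s]≡0) = inj₂ (inject₁ s
      , trans (cong suc (Fin.toℕ-inject₁ s)) (trans 1+s≡r (sym (Fin.toℕ-inject₁ r)))
      , trans (lookup-∷ʳ-inject₁ w 1F s) w[s]≡0)

  lastZero-∷ʳ0 : IsLastZero (w ∷ʳ 0F) (fromℕ N)
  lastZero-∷ʳ0 = lookup-∷ʳ-fromℕ w 0F , λ i _ → Fin.≤fromℕ i

  lastZeroCond-∷ʳ00 : LastZeroCond (w ∷ʳ 0F ∷ʳ 0F)
  -- Antisymmetry forces `t` to be the final position. The witness is the position before it, which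
  -- holds the other appended 0.
  lastZeroCond-∷ʳ00 t (_ , isLast) = inj₂ (inject₁ (fromℕ N)
    , trans (cong suc (Fin.toℕ-inject₁ (fromℕ N))) (sym (ℕ.≤-antisym (Fin.≤fromℕ t)
        (isLast (fromℕ (suc N)) (lookup-∷ʳ-fromℕ (w ∷ʳ 0F) 0F))))
    , trans (lookup-∷ʳ-inject₁ (w ∷ʳ 0F) 0F (fromℕ N)) (lookup-∷ʳ-fromℕ w 0F))

lastZeroCond-∷ʳ10 : ∀ {N} (w : Word N) → ¬ LastZeroCond (w ∷ʳ 1F ∷ʳ 0F)
lastZeroCond-∷ʳ10 {N} w cond with cond (fromℕ (suc N)) (lastZero-∷ʳ0 (w ∷ʳ 1F))
-- The first alternative is impossible, as the final position is `suc N`. In the second, `s` must be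
-- the position of the appended 1.
... | inj₂ (s , 1+s≡t , w[s]≡0) = contradiction w[s]≡1 (0F≢1F w[s]≡0)
  where
  s≡N : s ≡ inject₁ (fromℕ N)
  s≡N = Fin.toℕ-injective (trans (ℕ.suc-injective 1+s≡t) (sym (Fin.toℕ-inject₁ (fromℕ N))))
  w[s]≡1 : lookup (w ∷ʳ 1F ∷ʳ 0F) s ≡ 1F
  w[s]≡1 = trans (cong (lookup (w ∷ʳ 1F ∷ʳ 0F)) s≡N)
    (trans (lookup-∷ʳ-inject₁ (w ∷ʳ 1F) 0F (fromℕ N)) (lookup-∷ʳ-fromℕ w 1F))

-- Unlike in `𝒦̄`, the condition is imposed whatever the last letter is: stripping final 1s leads to
-- words ending in 0 that must still satisfy it.
lastZeroMaj : ∀ {N} → Word N → Poly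
lastZeroMaj w = guard (lastZeroCond? w) (q^ maj₀ w)

∑-lastZeroMaj-∷ʳ10 : ∀ N a b → ∑ᶜ₁ N a b (λ w → lastZeroMaj (w ∷ʳ 1F ∷ʳ 0F)) ≋ 0#
∑-lastZeroMaj-∷ʳ10 N zero    b = ≋-refl
∑-lastZeroMaj-∷ʳ10 N (suc a) b =
  ∑ᶜ-zero {N} {a} {b} λ w _ → guard-no (lastZeroCond? (w ∷ʳ 1F ∷ʳ 0F)) (lastZeroCond-∷ʳ10 w)

-- The final 0 is the only zero and not the first letter, so a 1 precedes it.
∑-lastZeroMaj-∷ʳ0-zero : ∀ N a → ∑ᶜ (suc N) a 0 (lastZeroMaj ∘ (_∷ʳ 0F)) ≋ 0#
∑-lastZeroMaj-∷ʳ0-zero N a =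
  ≋-trans (∑ᶜ-∷ʳ N a 0 (lastZeroMaj ∘ (_∷ʳ 0F))) (∑-lastZeroMaj-∷ʳ10 N a 0)

-- Among the words ending in 0 only those ending in 00 satisfy the condition. Dropping one of the
-- two zeros keeps maj and leads to `∑-maj-∷ʳ0`.
∑-lastZeroMaj-∷ʳ0-suc : ∀ N a b → a ℕ.+ b ≡ N →
  ∑ᶜ (suc N) a (suc b) (lastZeroMaj ∘ (_∷ʳ 0F)) ≋ q^ a * qbinom a b
∑-lastZeroMaj-∷ʳ0-suc N a b eq = begin
  ∑ᶜ (suc N) a (suc b) (lastZeroMaj ∘ (_∷ʳ 0F))          ≈⟨ ∑ᶜ-∷ʳ N a (suc b) (lastZeroMaj ∘ (_∷ʳ 0F)) ⟩
  ∑ᶜ N a b (λ w → lastZeroMaj (w ∷ʳ 0F ∷ʳ 0F)) + ∑ᶜ₁ N a (suc b) (λ w → lastZeroMaj (w ∷ʳ 1F ∷ʳ 0F))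
    ≈⟨ +-cong
         (∑ᶜ-≡ {N} {a} {b} λ w _ → trans
           (guard-yes (lastZeroCond? (w ∷ʳ 0F ∷ʳ 0F)) (lastZeroCond-∷ʳ00 w))
           (cong q^_ (majFrom-∷ʳ00 0 0F w)))
         (∑-lastZeroMaj-∷ʳ10 N a (suc b)) ⟩
  ∑ᶜ N a b (q^_ ∘ maj₀ ∘ (_∷ʳ 0F)) + 0#                  ≈⟨ +-identityʳ _ ⟩
  ∑ᶜ N a b (q^_ ∘ maj₀ ∘ (_∷ʳ 0F))                       ≈⟨ ∑-maj-∷ʳ0 N a b eq ⟩
  q^ a * qbinom a b                                      ∎
  where open ≈-Reasoning

∑-lastZeroMaj-∷ʳ1 : ∀ N a b → ∑ᶜ N a b (lastZeroMaj ∘ (_∷ʳ 1F)) ≋ ∑ᶜ N a b lastZeroMaj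
∑-lastZeroMaj-∷ʳ1 N a b = ∑ᶜ-≡ {N} {a} {b} λ w _ → trans
  (guard-⇔ (lastZeroCond? (w ∷ʳ 1F)) (lastZeroCond? w) (lastZeroCond-∷ʳ1 w))
  (cong (guard (lastZeroCond? w) ∘ q^_) (majFrom-∷ʳ1 0 0F w))

-- These words arise from arbitrary words of content `a`, `b` by doubling the last zero, or by
-- putting a 0 in front if there is none, and maj is kept. The proof avoids this map: splitting by
-- the last letter gives the two terms of `qbinom-pascal′`.
∑-lastZeroMaj : ∀ N a b → a ℕ.+ b ≡ N → ∑ᶜ (suc N) a (suc b) lastZeroMaj ≋ qbinom a b
-- The only word is the single letter 0, accepted by the alternative t = 1.
∑-lastZeroMaj zero    zero zero _  = ≋-refl
∑-lastZeroMaj (suc N) a    b    eq = ≋-trans (∑ᶜ-∷ʳ (suc N) a (suc b) lastZeroMaj) (cases a b eq)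
  where
  last₁ : ∀ a b → a ℕ.+ b ≡ N → ∑ᶜ (suc N) a (suc b) (lastZeroMaj ∘ (_∷ʳ 1F)) ≋ qbinom a b
  last₁ a b eq = ≋-trans (∑-lastZeroMaj-∷ʳ1 (suc N) a (suc b)) (∑-lastZeroMaj N a b eq)
  cases : ∀ a b → a ℕ.+ b ≡ suc N →
    ∑ᶜ (suc N) a b (lastZeroMaj ∘ (_∷ʳ 0F)) + ∑ᶜ₁ (suc N) a (suc b) (lastZeroMaj ∘ (_∷ʳ 1F))
      ≋ qbinom a b
  cases zero    (suc b) eq = ≋-trans (+-identityʳ _)
    (≋-trans (∑-lastZeroMaj-∷ʳ0-suc N 0 b (ℕ.suc-injective eq)) (*-identityˡ 1#))
  cases (suc a) zero    eq = ≋-trans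
    (+-cong (∑-lastZeroMaj-∷ʳ0-zero N (suc a)) (last₁ a 0 (ℕ.suc-injective eq)))
    (≡⇒≋ (qbinom-zeroʳ a))
  cases (suc a) (suc b) eq = ≋-trans
    (+-cong (∑-lastZeroMaj-∷ʳ0-suc N (suc a) b (trans (sym (ℕ.+-suc a b)) (ℕ.suc-injective eq)))
            (last₁ a (suc b) (ℕ.suc-injective eq)))
    (≋-sym (qbinom-pascal′ a b))

-- The two sums over Kaplansky words

module _ {n m} (m≤n : m ≤ n) {C : Pred (Word (suc n)) 0ℓ} (C? : Decidable C)
  (stat : Word (suc n) → ℕ) where

  private
    b = n ∸ m
    f : Word (suc n) → Poly
    f w = guard (C? w) (q^ stat w)

  -- The part common to both families, whose decision procedures are a content test followed by a
  -- further condition. The second hypothesis asks for `suc a ℕ.+ b ≡ n`, since a word ending in 1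
  -- contains a one; for m = 0 it demands nothing.
  ∑-kaplansky :
    ∑ᶜ n m b (f ∘ (_∷ʳ 0F)) ≋ q^ m * qbinom m b →
    (∀ a → suc a ℕ.+ b ≡ n → ∑ᶜ n a (suc b) (f ∘ (_∷ʳ 1F)) ≋ qbinom a b) →
    (∑[ w ∈ (λ w → hasContent? m (b ℕ.+ 1) w ×-dec C? w) ] (q^ stat w)) ≋ kaplansky m b
  ∑-kaplansky last₀ last₁ = begin
    (∑[ w ∈ (λ w → hasContent? m (b ℕ.+ 1) w ×-dec C? w) ] (q^ stat w))
      ≈⟨ ∑-filter (λ w → hasContent? m (b ℕ.+ 1) w ×-dec C? w) (words (suc n)) (q^_ ∘ stat) ⟩
    ∑ (words (suc n)) (λ w → guard (hasContent? m (b ℕ.+ 1) w ×-dec C? w) (q^ stat w))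
      ≈⟨ ∑-cong (words (suc n)) (λ w → ≡⇒≋ (guard-× (hasContent? m (b ℕ.+ 1) w) (C? w) (q^ stat w))) ⟩
    ∑ᶜ (suc n) m (b ℕ.+ 1) f                          ≡⟨ cong (λ k → ∑ᶜ (suc n) m k f) (ℕ.+-comm b 1) ⟩
    ∑ᶜ (suc n) m (suc b) f                            ≈⟨ ∑ᶜ-∷ʳ n m (suc b) f ⟩
    ∑ᶜ n m b (f ∘ (_∷ʳ 0F)) + ∑ᶜ₁ n m (suc b) (f ∘ (_∷ʳ 1F))
      ≈⟨ cases m refl (ℕ.m+[n∸m]≡n m≤n) ⟩
    kaplansky m b                                     ∎
    where
    open ≈-Reasoning
    -- The case distinction is on a copy `k` of `m`, so that `b`, which depends on `m`, stays fixed.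
    cases : ∀ k → k ≡ m → k ℕ.+ b ≡ n →
      ∑ᶜ n m b (f ∘ (_∷ʳ 0F)) + ∑ᶜ₁ n k (suc b) (f ∘ (_∷ʳ 1F)) ≋ kaplansky k b
    cases zero    refl eq = ≋-trans (+-identityʳ _) (≋-trans last₀ (*-identityˡ 1#))
    cases (suc a) refl eq = +-cong last₀ (last₁ a eq)

-- Words ending in 0 satisfy the condition vacuously. A word ending in 1 satisfies it exactly when
-- it is 0v1, and then it has the inversions of the arbitrary word v.
∑-𝒦 : ∀ {n m} → m ≤ n → (∑[ w ∈ 𝒦? n m ] (q^ inv w)) ≋ kaplansky m (n ∸ m)
∑-𝒦 {n} {m} m≤n = ∑-kaplansky m≤n C? inv last₀ (last₁ n)
  where
  C? : ∀ {n} → Decidable λ (w : Word (suc n)) → lookup w (fromℕ n) ≡ 1F → lookup w zero ≡ 0F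
  C? {n} w = (lookup w (fromℕ n) Fin.≟ 1F) →-dec (lookup w zero Fin.≟ 0F)
  last₀ : ∑ᶜ n m (n ∸ m) (λ w → guard (C? (w ∷ʳ 0F)) (q^ inv (w ∷ʳ 0F)))
        ≋ q^ m * qbinom m (n ∸ m)
  last₀ = ≋-trans
    (∑ᶜ-≡ {n} {m} λ w _ → guard-yes (C? (w ∷ʳ 0F)) λ w[n]≡1 →
      contradiction w[n]≡1 (0F≢1F (lookup-∷ʳ-fromℕ w 0F)))
    (∑-inv-∷ʳ0 n m (n ∸ m) (ℕ.m+[n∸m]≡n m≤n))
  -- `n` is a variable again so that it can be matched as a successor: this separates the first
  -- letter from the final 1.
  last₁ : ∀ n {b} a → suc a ℕ.+ b ≡ n →
    ∑ᶜ n a (suc b) (λ w → guard (C? (w ∷ʳ 1F)) (q^ inv (w ∷ʳ 1F))) ≋ qbinom a b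
  last₁ (suc n) {b} a eq = begin
    ∑ᶜ (suc n) a (suc b) f                                     ≈⟨ ∑ᶜ-∷ n a (suc b) f ⟩
    ∑ᶜ n a b (f ∘ (0F ∷_)) + ∑ᶜ₁ n a (suc b) (f ∘ (1F ∷_))     ≈⟨ +-cong first₀ (first₁ a) ⟩
    ∑ᶜ n a b (q^_ ∘ inv) + 0#                                  ≈⟨ +-identityʳ _ ⟩
    ∑ᶜ n a b (q^_ ∘ inv)                                       ≈⟨ ∑-inv n a b (ℕ.suc-injective eq) ⟩
    qbinom a b                                                 ∎
    where
    open ≈-Reasoning
    f : Word (suc n) → Poly
    f w = guard (C? (w ∷ʳ 1F)) (q^ inv (w ∷ʳ 1F))
    first₀ : ∑ᶜ n a b (f ∘ (0F ∷_)) ≋ ∑ᶜ n a b (q^_ ∘ inv)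
    first₀ = ∑ᶜ-≡ {n} {a} {b} λ w _ → trans
      (guard-yes (C? (0F ∷ (w ∷ʳ 1F))) λ _ → refl)
      (cong q^_ (trans (inv-0∷ (w ∷ʳ 1F)) (inv-∷ʳ1 w)))
    first₁ : ∀ a → ∑ᶜ₁ n a (suc b) (f ∘ (1F ∷_)) ≋ 0#
    first₁ zero    = ≋-refl
    first₁ (suc a) = ∑ᶜ-zero {n} {a} λ w _ → guard-no (C? (1F ∷ (w ∷ʳ 1F))) λ cond →
      contradiction refl (0F≢1F (cond (lookup-∷ʳ-fromℕ (1F ∷ w) 1F)))

-- Words ending in 0 again satisfy the condition vacuously. Deleting a final 1 changes neither maj
-- nor the condition on the last zero, which reduces the rest to `∑-lastZeroMaj`.
∑-𝒦̄ : ∀ {n m} → m ≤ n → (∑[ w ∈ 𝒦̄? n m ] (q^ maj w)) ≋ kaplansky m (n ∸ m)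
∑-𝒦̄ {n} {m} m≤n = ∑-kaplansky m≤n C? maj last₀ (last₁ n)
  where
  C? : ∀ {n} → Decidable λ (w : Word (suc n)) → lookup w (fromℕ n) ≡ 1F → LastZeroCond w
  C? {n} w = (lookup w (fromℕ n) Fin.≟ 1F) →-dec lastZeroCond? w
  last₀ : ∑ᶜ n m (n ∸ m) (λ w → guard (C? (w ∷ʳ 0F)) (q^ maj (w ∷ʳ 0F)))
        ≋ q^ m * qbinom m (n ∸ m)
  last₀ = ≋-trans
    (∑ᶜ-≡ {n} {m} λ w _ → trans
      (guard-yes (C? (w ∷ʳ 0F)) λ w[n]≡1 →
        contradiction w[n]≡1 (0F≢1F (lookup-∷ʳ-fromℕ w 0F)))
      (cong q^_ (maj≡maj₀ (w ∷ʳ 0F))))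
    (∑-maj-∷ʳ0 n m (n ∸ m) (ℕ.m+[n∸m]≡n m≤n))
  last₁ : ∀ n {b} a → suc a ℕ.+ b ≡ n →
    ∑ᶜ n a (suc b) (λ w → guard (C? (w ∷ʳ 1F)) (q^ maj (w ∷ʳ 1F))) ≋ qbinom a b
  last₁ (suc n) {b} a eq = ≋-trans
    (∑ᶜ-≡ {suc n} {a} {suc b} λ w _ → trans
      (guard-⇔ (C? (w ∷ʳ 1F)) (lastZeroCond? w) (mk⇔
        (λ cond → Equivalence.to (lastZeroCond-∷ʳ1 w) (cond (lookup-∷ʳ-fromℕ w 1F)))
        (λ cond _ → Equivalence.from (lastZeroCond-∷ʳ1 w) cond)))
      (cong (guard (lastZeroCond? w) ∘ q^_) (trans (maj≡maj₀ (w ∷ʳ 1F)) (majFrom-∷ʳ1 0 0F w))))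
    (∑-lastZeroMaj n a b (ℕ.suc-injective eq))

theorem1p1 : (n m : ℕ) .{{_ : NonZero n}} → m ≤ n →
    (qKaplansky n m ≃ fromPoly (∑[ w ∈ 𝒦? n m ] (q^ inv w)))
    × (∑[ w ∈ 𝒦? n m ] (q^ inv w)) ≈ (∑[ w ∈ 𝒦̄? n m ] (q^ maj w))
theorem1p1 n m m≤n =
  -- In the cross-multiplied equation the polynomial occurs only as a factor next to the denominator
  -- of `qKaplansky n m`, so it is replaced by congruence, without cancelling.
  (λ k → trans (qKaplansky≃kaplansky m≤n k)
    (coeffs (*-congʳ (den (qKaplansky n m)) (≋-sym (∑-𝒦 m≤n))) k))
  , coeffs (≋-trans (∑-𝒦 m≤n) (≋-sym (∑-𝒦̄ m≤n)))
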